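{- For a nonnegative integer $n$, let $p_{1,3}(n)$ be defined by $\sum_{n\geq0}p_{1,3}(n)q^n=\prod_{m\geq1}(1-q^m)^{ -6}$. Then for all integers $n\geq0$ and $\alpha\geq1$, \begin{align*} p_{1,3}\left(3^{2\alpha-1}n+\tfrac{3^{2\alpha-1}+1}{4}\right) &\equiv0\pmod{3^{2\alpha-1}},\\ p_{1,3}\left(3^{2\alpha+1}n+\tfrac{7\cdot3^{2\alpha}+1}{4}\right) &\equiv0\pmod{3^{2\alpha+3}},\\ p_{1,3}\left(3^{2\alpha+1}n+\tfrac{11\cdot3^{2\alpha}+1}{4}\right) &\equiv0\pmod{3^{2\alpha+4}},\\ p_{1,3}\left(3^{2\alpha}n+\tfrac{5\cdot3^{2\alpha-1}+1}{4}\right) &\equiv0\pmod{3^{2\alpha}},\\ p_{1,3}\left(3^{2\alpha}n+\tfrac{3^{2\alpha+1}+1}{4}\right) &\equiv0\pmod{3^{2\alpha+1}}. \end{align*}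
   Context: In general $p_{k,3}(n)$ is defined by $\sum_{n\ge0}p_{k,3}(n)q^n=\frac{1}{(q;q)_\infty^3(q^k;q^k)_\infty^3}$ where $(a;q)_\infty=\prod_{n\ge0}(1-aq^n)$; it counts 2-color partition triples of $n$ where one of the colors appears only in parts that are multiples of $k$. Here $k=1$. -}

module Defs where

open import Data.Nat using (ℕ; zero; suc; _+_; _*_; _∸_)
open import Data.Nat.DivMod using (_%_)
open import Data.List using (map; upTo)
open import Data.Nat.ListAction using (sum)

Series : Set
Series = ℕ → ℕ

_⊛_ : Series → Series → Series
(f ⊛ g) n = sum (map (λ i → f i * g (n ∸ i)) (upTo (suc n)))

one : Series
one zero    = 1
one (suc _) = 0

-- The inverse (1 - q^m)^{-1} = Σ_{j≥0} q^{m j}, for m ≥ 1 (argument is m - 1).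
geomInv : ℕ → Series
geomInv m n with n % suc m
... | zero  = 1
... | suc _ = 0

prodInvUpTo : ℕ → Series
prodInvUpTo zero    = one
prodInvUpTo (suc N) = prodInvUpTo N ⊛ geomInv N

-- ∏_{m≥1} (1 - q^m)^{-1}: its n-th coefficient equals that of the finite
-- product over 1 ≤ m ≤ n (factors with m > n do not affect q^n).
prodInv : Series
prodInv n = prodInvUpTo n n

p13 : ℕ → ℕ
p13 = prodInv ⊛ (prodInv ⊛ (prodInv ⊛ (prodInv ⊛ (prodInv ⊛ prodInv))))

{-# OPTIONS --safe #-}

-- Write E = ∏ (1 - qᵐ), e = E³, and let U_r collect the coefficients in the residue class r mod 3.
-- Jacobi's identity gives the 3-dissection e = A(q³) - 3q e(q⁹), and taking the norm from ℤ⟦q⟧ to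
-- ℤ⟦q³⟧ gives A³ - 27 q e(q³)³ = e⁴ / e(q³).  Hence w = q e(q⁹)/e and t = q e(q³)⁴/e⁴ satisfy
--   t = w + 9w² + 27w³,   w³ = t(q³)(1 + 9w + 27w²),
--   U₀ w = 9t,   U₀ w² = 6t + 243t²,   U₂ w ≡ 0 (mod 3).
-- With v = 3w and τ = 27t it follows that U₀ maps t ℤ[τ] ⊆ w ℤ[v] into 9t ℤ[τ], and w² t ℤ[τ] into
-- t ℤ[τ].  Starting from 1/e² = Σ p₁,₃(n) qⁿ, these two operations produce in turn the generating
-- functions along the progressions of the theorem, times q e(q³)² or q e², so every second step gains
-- a factor 9.  The remaining residue classes are read off modulo 27 from the leading coefficient of
-- the polynomial in t.
module Submission where

open import Algebra.Bundles using (CommutativeRing)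
open import Algebra.Bundles.Raw using (RawRing)
import Algebra.Solver.Ring
open import Algebra.Solver.Ring.AlmostCommutativeRing
  using (fromCommutativeRing; _-Raw-AlmostCommutative⟶_)
open import Algebra.Structures using (IsCommutativeRing)
open import Data.Fin using (Fin; toℕ; suc)
open import Data.Fin.Patterns using (0F; 1F; 2F)
import Data.Fin.Properties as Fin
import Data.Integer as ℤ
open import Data.Integer using (ℤ; +_; -[1+_])
import Data.Integer.Properties as ℤ
import Data.Integer.Tactic.RingSolver as ℤ-Solver
open import Data.List using (applyUpTo)
open import Data.List.Properties using (map-applyUpTo)
open import Data.Maybe using (Maybe; just; nothing)
import Data.Nat as ℕ
open import Data.Nat using (ℕ; zero; suc; z≤n; s≤s)
open import Data.Nat.DivMod using (_/_; _%_; m*n/n≡m; m<n⇒m%n≡m; [m+n]%n≡m%n)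
open import Data.Nat.Divisibility using (_∣_; divides)
open import Data.Nat.ListAction using (sum)
import Data.Nat.Properties as ℕ
import Data.Nat.Tactic.RingSolver as ℕ-Solver
open import Data.Product using (_,_; _×_; ∃)
open import Level using (0ℓ)
open import Relation.Binary.PropositionalEquality
  using (_≡_; refl; sym; trans; cong; cong₂; subst; module ≡-Reasoning)
open import Relation.Nullary using (yes; no)
open import Defs

-- The scaling v = 3w, τ = 27t is dictated by U₀ w² = 6t + 243t², which is divisible by 3 but not by
-- 9: on w ℤ[w] the factor 9 would be lost, whereas each extra v brings in the missing 3. In the
-- scaled variables t = w(1 + 3v + 3v²) and v³ = τ(q³)(1 + 3v + 3v²), so closure under U₀ needs only
-- three consecutive powers of v. Infinite products are known only coefficient by coefficient.
-- Jacobi's identity and the norm of E therefore rest on exact identities between finite products,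
-- compared with their limits modulo qⁿ⁺¹. The norm is taken as a cubic form in the three dissection
-- components, so no cube roots of unity are adjoined to ℤ. Division is replaced by the explicit
-- inverses p of e and M of N = A³ - 27q e(q³)³; the relations between w and t then become
-- polynomial identities modulo e p = 1 and N M = 1.

infix  4 _≈_
infixl 6 _⊕_
infixl 7 _⊗_
infix  8 ⊝_

-- The ring of formal power series over ℤ

ℤ⟦q⟧ : Set
ℤ⟦q⟧ = ℕ → ℤ

-- Wrapping pointwise equality in a record lets both series be inferred from the type of a proof.
record _≈_ (f g : ℤ⟦q⟧) : Set where
  constructor coeffs
  field coeff : ∀ n → f n ≡ g n
open _≈_

tl : ℤ⟦q⟧ → ℤ⟦q⟧
tl f n = f (suc n)

const : ℤ → ℤ⟦q⟧
const c zero    = c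
const c (suc _) = + 0

const₀-coeff : ∀ n → const (+ 0) n ≡ + 0
const₀-coeff zero    = refl
const₀-coeff (suc _) = refl

opaque
  _⊕_ : ℤ⟦q⟧ → ℤ⟦q⟧ → ℤ⟦q⟧
  (f ⊕ g) n = f n ℤ.+ g n

  ⊝_ : ℤ⟦q⟧ → ℤ⟦q⟧
  (⊝ f) n = ℤ.- f n

  -- The Cauchy product read off from f = f₀ + q · `tl f`, which gives structural recursion in place
  -- of finite sums.
  _⊗_ : ℤ⟦q⟧ → ℤ⟦q⟧ → ℤ⟦q⟧
  (f ⊗ g) zero    = f 0 ℤ.* g 0
  (f ⊗ g) (suc n) = f 0 ℤ.* g (suc n) ℤ.+ (tl f ⊗ g) n

opaque
  unfolding _⊕_

  ⊕-coeff : ∀ f g n → (f ⊕ g) n ≡ f n ℤ.+ g n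
  ⊕-coeff f g n = refl

  ⊝-coeff : ∀ f n → (⊝ f) n ≡ ℤ.- f n
  ⊝-coeff f n = refl

  ⊗-coeff₀ : ∀ f g → (f ⊗ g) 0 ≡ f 0 ℤ.* g 0
  ⊗-coeff₀ f g = refl

  ⊗-coeff₁ : ∀ f g n → (f ⊗ g) (suc n) ≡ f 0 ℤ.* g (suc n) ℤ.+ (tl f ⊗ g) n
  ⊗-coeff₁ f g n = refl

  -- Coefficient n of a product sees only indices up to n. The bounded form serves the setoid
  -- congruence and the truncation arguments alike.
  ⊗-cong-upTo : ∀ n {f f′ g g′} → (∀ i → i ℕ.≤ n → f i ≡ f′ i) →
                (∀ i → i ℕ.≤ n → g i ≡ g′ i) → (f ⊗ g) n ≡ (f′ ⊗ g′) n
  ⊗-cong-upTo zero    p r = cong₂ ℤ._*_ (p 0 z≤n) (r 0 z≤n)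
  ⊗-cong-upTo (suc n) p r = cong₂ ℤ._+_
    (cong₂ ℤ._*_ (p 0 z≤n) (r (suc n) ℕ.≤-refl))
    (⊗-cong-upTo n (λ i i≤n → p (suc i) (s≤s i≤n)) (λ i i≤n → r i (ℕ.m≤n⇒m≤1+n i≤n)))

  ⊗-distribʳ : ∀ h f g n → ((f ⊕ g) ⊗ h) n ≡ (f ⊗ h ⊕ g ⊗ h) n
  ⊗-distribʳ h f g zero    = ℤ.*-distribʳ-+ (h 0) (f 0) (g 0)
  ⊗-distribʳ h f g (suc n) = trans
    (cong (λ z → (f 0 ℤ.+ g 0) ℤ.* h (suc n) ℤ.+ z) (⊗-distribʳ h (tl f) (tl g) n))
    (lem (f 0) (g 0) (h (suc n)) ((tl f ⊗ h) n) ((tl g ⊗ h) n))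
    where
    lem : ∀ a b c x y → (a ℤ.+ b) ℤ.* c ℤ.+ (x ℤ.+ y) ≡ (a ℤ.* c ℤ.+ x) ℤ.+ (b ℤ.* c ℤ.+ y)
    lem = ℤ-Solver.solve-∀

  ⊗-const : ∀ c g n → (const c ⊗ g) n ≡ c ℤ.* g n
  ⊗-const c g zero    = refl
  ⊗-const c g (suc n) = trans (cong (λ z → c ℤ.* g (suc n) ℤ.+ z) (zeros n)) (ℤ.+-identityʳ _)
    where
    zeros : ∀ n → ((λ _ → + 0) ⊗ g) n ≡ + 0
    zeros zero    = refl
    zeros (suc n) = trans (ℤ.+-identityˡ _) (zeros n)

  -- The mirror image of the defining recursion; commutativity is the comparison of the two.
  ⊗-coeff₁ʳ : ∀ f g n → (f ⊗ g) (suc n) ≡ f (suc n) ℤ.* g 0 ℤ.+ (f ⊗ tl g) n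
  ⊗-coeff₁ʳ f g zero    = ℤ.+-comm (f 0 ℤ.* g 1) (f 1 ℤ.* g 0)
  ⊗-coeff₁ʳ f g (suc n) = trans
    (cong (λ z → f 0 ℤ.* g (suc (suc n)) ℤ.+ z) (⊗-coeff₁ʳ (tl f) g n))
    (lem (f 0 ℤ.* g (suc (suc n))) (f (suc (suc n)) ℤ.* g 0) ((tl f ⊗ tl g) n))
    where
    lem : ∀ a b c → a ℤ.+ (b ℤ.+ c) ≡ b ℤ.+ (a ℤ.+ c)
    lem = ℤ-Solver.solve-∀

  ⊗-comm : ∀ f g n → (f ⊗ g) n ≡ (g ⊗ f) n
  ⊗-comm f g zero    = ℤ.*-comm (f 0) (g 0)
  ⊗-comm f g (suc n) = trans
    (cong₂ ℤ._+_ (ℤ.*-comm (f 0) (g (suc n))) (⊗-comm (tl f) g n))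
    (sym (⊗-coeff₁ʳ g f n))

  ⊗-assoc : ∀ f g h n → ((f ⊗ g) ⊗ h) n ≡ (f ⊗ (g ⊗ h)) n
  ⊗-assoc f g h zero    = ℤ.*-assoc (f 0) (g 0) (h 0)
  ⊗-assoc f g h (suc n) = begin
    f 0 ℤ.* g 0 ℤ.* h (suc n) ℤ.+ (tl (f ⊗ g) ⊗ h) n
      ≡⟨ cong (λ z → f 0 ℤ.* g 0 ℤ.* h (suc n) ℤ.+ z) (trans
           (⊗-cong-upTo n (λ i _ → cong (ℤ._+ (tl f ⊗ g) i) (sym (⊗-const (f 0) (tl g) i)))
                          (λ _ _ → refl))
           (⊗-distribʳ h (const (f 0) ⊗ tl g) (tl f ⊗ g) n)) ⟩
    f 0 ℤ.* g 0 ℤ.* h (suc n) ℤ.+ (((const (f 0) ⊗ tl g) ⊗ h) n ℤ.+ ((tl f ⊗ g) ⊗ h) n)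
      ≡⟨ cong₂ (λ x y → f 0 ℤ.* g 0 ℤ.* h (suc n) ℤ.+ (x ℤ.+ y))
           (scalar n (tl g)) (⊗-assoc (tl f) g h n) ⟩
    f 0 ℤ.* g 0 ℤ.* h (suc n) ℤ.+ (f 0 ℤ.* (tl g ⊗ h) n ℤ.+ (tl f ⊗ (g ⊗ h)) n)
      ≡⟨ lem (f 0) (g 0) (h (suc n)) _ _ ⟩
    f 0 ℤ.* (g 0 ℤ.* h (suc n) ℤ.+ (tl g ⊗ h) n) ℤ.+ (tl f ⊗ (g ⊗ h)) n ∎
    where
    open ≡-Reasoning
    lem : ∀ a b c x y → a ℤ.* b ℤ.* c ℤ.+ (a ℤ.* x ℤ.+ y) ≡ a ℤ.* (b ℤ.* c ℤ.+ x) ℤ.+ y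
    lem = ℤ-Solver.solve-∀
    scalar : ∀ n k → ((const (f 0) ⊗ k) ⊗ h) n ≡ f 0 ℤ.* (k ⊗ h) n
    scalar zero    k = ℤ.*-assoc (f 0) (k 0) (h 0)
    scalar (suc n) k = trans
      (cong (λ z → f 0 ℤ.* k 0 ℤ.* h (suc n) ℤ.+ z)
        (trans (⊗-cong-upTo n
                 (λ i _ → trans (⊗-const (f 0) k (suc i)) (sym (⊗-const (f 0) (tl k) i)))
                 (λ _ _ → refl))
               (scalar n (tl k))))
      (lem′ (f 0) (k 0) (h (suc n)) ((tl k ⊗ h) n))
      where
      lem′ : ∀ a b c x → a ℤ.* b ℤ.* c ℤ.+ a ℤ.* x ≡ a ℤ.* (b ℤ.* c ℤ.+ x)
      lem′ = ℤ-Solver.solve-∀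

  isCommutativeRing : IsCommutativeRing _≈_ _⊕_ _⊗_ ⊝_ (const (+ 0)) (const (+ 1))
  isCommutativeRing = record
    { isRing = record
      { +-isAbelianGroup = record
        { isGroup = record
          { isMonoid = record
            { isSemigroup = record
              { isMagma = record
                { isEquivalence = record
                  { refl  = coeffs λ _ → refl
                  ; sym   = λ p → coeffs λ n → sym (coeff p n)
                  ; trans = λ p r → coeffs λ n → trans (coeff p n) (coeff r n)
                  }
                ; ∙-cong = λ p r → coeffs λ n → cong₂ ℤ._+_ (coeff p n) (coeff r n)
                }
              ; assoc = λ f g h → coeffs λ n → ℤ.+-assoc (f n) (g n) (h n)
              }
            ; identity = (λ f → coeffs λ n → trans (cong (ℤ._+ f n) (const₀-coeff n)) (ℤ.+-identityˡ _))
                       , (λ f → coeffs λ n → trans (cong (λ z → f n ℤ.+ z) (const₀-coeff n)) (ℤ.+-identityʳ _))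
            }
          ; inverse = (λ f → coeffs λ n → trans (ℤ.+-inverseˡ (f n)) (sym (const₀-coeff n)))
                    , (λ f → coeffs λ n → trans (ℤ.+-inverseʳ (f n)) (sym (const₀-coeff n)))
          ; ⁻¹-cong = λ p → coeffs λ n → cong ℤ.-_ (coeff p n)
          }
        ; comm = λ f g → coeffs λ n → ℤ.+-comm (f n) (g n)
        }
      ; *-cong = λ p r → coeffs λ n → ⊗-cong-upTo n (λ i _ → coeff p i) (λ i _ → coeff r i)
      ; *-assoc = λ f g h → coeffs (⊗-assoc f g h)
      ; *-identity = (λ f → coeffs (idˡ f))
                   , (λ f → coeffs λ n → trans (⊗-comm f (const (+ 1)) n) (idˡ f n))
      ; distrib = (λ f g h → coeffs λ n → trans (⊗-comm f (g ⊕ h) n) (trans (⊗-distribʳ f g h n)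
                    (cong₂ ℤ._+_ (⊗-comm g f n) (⊗-comm h f n))))
                , (λ f g h → coeffs (⊗-distribʳ f g h))
      }
    ; *-comm = λ f g → coeffs (⊗-comm f g)
    }
    where
    idˡ : ∀ f n → (const (+ 1) ⊗ f) n ≡ f n
    idˡ f n = trans (⊗-const (+ 1) f n) (ℤ.*-identityˡ _)

seriesRing : CommutativeRing 0ℓ 0ℓ
seriesRing = record { isCommutativeRing = isCommutativeRing }

module S = CommutativeRing seriesRing
open import Relation.Binary.Reasoning.Setoid S.setoid
open import Algebra.Properties.Semiring.Exp S.semiring
  using (^-homo-*; ^-congˡ) renaming (_^_ to _↑_)

opaque
  unfolding _⊕_

  const-+ : ∀ a b → const (a ℤ.+ b) ≈ const a ⊕ const b
  const-+ a b = coeffs λ { zero → refl ; (suc _) → refl }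

  const-- : ∀ a → const (ℤ.- a) ≈ ⊝ const a
  const-- a = coeffs λ { zero → refl ; (suc _) → refl }

  const-* : ∀ a b → const (a ℤ.* b) ≈ const a ⊗ const b
  const-* a b = coeffs λ where
    zero    → refl
    (suc n) → sym (trans (⊗-const a (const b) (suc n)) (ℤ.*-zeroʳ a))

ℤ-rawRing : RawRing 0ℓ 0ℓ
ℤ-rawRing = CommutativeRing.rawRing ℤ.+-*-commutativeRing

-- Integers serve as solver coefficients, so that numerals such as 27 and 243 are computed with
-- rather than treated as atoms.
const-morphism : ℤ-rawRing -Raw-AlmostCommutative⟶ fromCommutativeRing seriesRing
const-morphism = record
  { ⟦_⟧    = const
  ; +-homo = const-+
  ; *-homo = const-*
  ; -‿homo = const--
  ; 0-homo = S.refl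
  ; 1-homo = S.refl
  }

_coeff≟_ : (a b : ℤ) → Maybe (const a ≈ const b)
a coeff≟ b with a ℤ.≟ b
... | yes refl = just S.refl
... | no  _    = nothing

module Solver = Algebra.Solver.Ring ℤ-rawRing (fromCommutativeRing seriesRing) const-morphism _coeff≟_
open Solver using (solve; _:=_; _:+_; _:*_; _:-_; :-_; con; _:^_)

# : ℕ → ℤ⟦q⟧
# n = const (+ n)

-- Truncated congruences and limits

infix 4 _≈[_]_

-- Congruence modulo qⁿ⁺¹ (the bound is inclusive).
_≈[_]_ : ℤ⟦q⟧ → ℕ → ℤ⟦q⟧ → Set
f ≈[ n ] g = ∀ i → i ℕ.≤ n → f i ≡ g i

≈[]-refl : ∀ {f n} → f ≈[ n ] f
≈[]-refl i i≤n = refl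

≈[]-sym : ∀ {f g n} → f ≈[ n ] g → g ≈[ n ] f
≈[]-sym p i i≤n = sym (p i i≤n)

≈[]-trans : ∀ {f g h n} → f ≈[ n ] g → g ≈[ n ] h → f ≈[ n ] h
≈[]-trans p r i i≤n = trans (p i i≤n) (r i i≤n)

≈[]-weaken : ∀ {f g m n} → m ℕ.≤ n → f ≈[ n ] g → f ≈[ m ] g
≈[]-weaken m≤n p i i≤m = p i (ℕ.≤-trans i≤m m≤n)

≈⇒≈[] : ∀ {f g n} → f ≈ g → f ≈[ n ] g
≈⇒≈[] p i _ = coeff p i

≈[]⇒≈ : ∀ {f g} → (∀ n → f ≈[ n ] g) → f ≈ g
≈[]⇒≈ p = coeffs λ n → p n n ℕ.≤-refl

⊗-cong-≈[] : ∀ {f f′ g g′ n} → f ≈[ n ] f′ → g ≈[ n ] g′ → f ⊗ g ≈[ n ] f′ ⊗ g′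
⊗-cong-≈[] p r i i≤n = ⊗-cong-upTo i
  (λ j j≤i → p j (ℕ.≤-trans j≤i i≤n)) (λ j j≤i → r j (ℕ.≤-trans j≤i i≤n))

⊕-cong-≈[] : ∀ {f f′ g g′ n} → f ≈[ n ] f′ → g ≈[ n ] g′ → f ⊕ g ≈[ n ] f′ ⊕ g′
⊕-cong-≈[] {f} {f′} {g} {g′} p r i i≤n = trans (⊕-coeff f g i)
  (trans (cong₂ ℤ._+_ (p i i≤n) (r i i≤n)) (sym (⊕-coeff f′ g′ i)))

⊝-cong-≈[] : ∀ {f g n} → f ≈[ n ] g → ⊝ f ≈[ n ] ⊝ g
⊝-cong-≈[] {f} {g} p i i≤n =
  trans (⊝-coeff f i) (trans (cong ℤ.-_ (p i i≤n)) (sym (⊝-coeff g i)))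

-- From stage i on, coefficient i no longer changes. The limit is given as a diagonal because
-- `prodInv` is defined as one.
diagonal-limit : (F : ℕ → ℤ⟦q⟧) → (∀ n → F (suc n) ≈[ n ] F n) →
                 ∀ n → F n ≈[ n ] (λ i → F i i)
diagonal-limit F stable n i i≤n = subst (λ m → F m i ≡ F i i) (ℕ.m∸n+n≡m i≤n) (go (n ℕ.∸ i))
  where
  go : ∀ k → F (k ℕ.+ i) i ≡ F i i
  go zero    = refl
  go (suc k) = trans (stable (k ℕ.+ i) i (ℕ.m≤n+m i k)) (go k)

-- Powers of q and Euler's product

q : ℤ⟦q⟧
q zero    = + 0
q (suc n) = const (+ 1) n

q⊗-zero : ∀ f → (q ⊗ f) 0 ≡ + 0
q⊗-zero f = ⊗-coeff₀ q f

q⊗-suc : ∀ f n → (q ⊗ f) (suc n) ≡ f n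
q⊗-suc f n = trans (⊗-coeff₁ q f n) (trans (ℤ.+-identityˡ _) (coeff (S.*-identityˡ f) n))

q⊗-cong-≈[] : ∀ {f g n} → f ≈[ n ] g → q ⊗ f ≈[ suc n ] q ⊗ g
q⊗-cong-≈[] {f} {g} p zero    _         = trans (q⊗-zero f) (sym (q⊗-zero g))
q⊗-cong-≈[] {f} {g} p (suc i) (s≤s i≤n) = trans (q⊗-suc f i) (trans (p i i≤n) (sym (q⊗-suc g i)))

q↑⊗-below : ∀ k f i → i ℕ.< k → (q ↑ k ⊗ f) i ≡ + 0
q↑⊗-below (suc k) f zero    _         = trans (coeff (S.*-assoc q (q ↑ k) f) 0) (q⊗-zero _)
q↑⊗-below (suc k) f (suc i) (s≤s i<k) = trans (coeff (S.*-assoc q (q ↑ k) f) (suc i))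
  (trans (q⊗-suc _ i) (q↑⊗-below k f i i<k))

q↑⊗-shift : ∀ k f i → (q ↑ k ⊗ f) (k ℕ.+ i) ≡ f i
q↑⊗-shift zero    f i = coeff (S.*-identityˡ f) i
q↑⊗-shift (suc k) f i = trans (coeff (S.*-assoc q (q ↑ k) f) (suc k ℕ.+ i))
  (trans (q⊗-suc _ (k ℕ.+ i)) (q↑⊗-shift k f i))

q↑-small : ∀ n → q ↑ suc n ≈[ n ] # 0
q↑-small n i i≤n = trans (sym (coeff (S.*-identityʳ (q ↑ suc n)) i))
  (trans (q↑⊗-below (suc n) (# 1) i (s≤s i≤n)) (sym (const₀-coeff i)))

infix 9 1-q^_

1-q^_ : ℕ → ℤ⟦q⟧
1-q^ k = # 1 ⊕ ⊝ (q ↑ k)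

qPoch : ℕ → ℤ⟦q⟧
qPoch zero    = # 1
qPoch (suc n) = qPoch n ⊗ 1-q^ (suc n)

⊗-1-q^ : ∀ f n → f ⊗ 1-q^ (suc n) ≈[ n ] f
⊗-1-q^ f n = ≈[]-trans
  (⊗-cong-≈[] (≈[]-refl {f}) (⊕-cong-≈[] ≈[]-refl (⊝-cong-≈[] (q↑-small n))))
  (≈⇒≈[] (solve 1 (λ f → f :* (con (+ 1) :- con (+ 0)) := f) S.refl f))

qPoch∞ : ℤ⟦q⟧
qPoch∞ n = qPoch n n

qPoch→qPoch∞ : ∀ n → qPoch n ≈[ n ] qPoch∞
qPoch→qPoch∞ = diagonal-limit qPoch (λ n → ⊗-1-q^ (qPoch n) n)

-- The partition series as inverse of Euler's product

ι : Series → ℤ⟦q⟧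
ι f n = + f n

ι-⊛ : ∀ f g → ι (f ⊛ g) ≈ ι f ⊗ ι g
ι-⊛ f g = coeffs λ n → trans (cong +_ (⊛-applyUpTo f g n)) (sym (⊗-applyUpTo f g n))
  where
  ⊛-applyUpTo : ∀ f g n → (f ⊛ g) n ≡ sum (applyUpTo (λ i → f i ℕ.* g (n ℕ.∸ i)) (suc n))
  ⊛-applyUpTo f g n = cong sum (map-applyUpTo (λ i → i) (λ i → f i ℕ.* g (n ℕ.∸ i)) (suc n))
  ⊗-applyUpTo : ∀ f g n → (ι f ⊗ ι g) n ≡ + sum (applyUpTo (λ i → f i ℕ.* g (n ℕ.∸ i)) (suc n))
  ⊗-applyUpTo f g zero    = trans (⊗-coeff₀ (ι f) (ι g))
    (trans (sym (ℤ.pos-* (f 0) (g 0))) (cong +_ (sym (ℕ.+-identityʳ _))))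
  ⊗-applyUpTo f g (suc n) = trans (⊗-coeff₁ (ι f) (ι g) n)
    (cong₂ ℤ._+_ (sym (ℤ.pos-* (f 0) (g (suc n)))) (⊗-applyUpTo (λ i → f (suc i)) g n))

ι-one : ι one ≈ # 1
ι-one = coeffs λ { zero → refl ; (suc _) → refl }

qPoch⁻¹ : ℕ → ℤ⟦q⟧
qPoch⁻¹ k = ι (prodInvUpTo k)

qPoch∞⁻¹ : ℤ⟦q⟧
qPoch∞⁻¹ = ι prodInv

geomInv-multiple : ∀ m n → n % suc m ≡ 0 → geomInv m n ≡ 1
geomInv-multiple m n eq with n % suc m
geomInv-multiple m n refl | zero = refl

geomInv-nonmultiple : ∀ m n {r} → n % suc m ≡ suc r → geomInv m n ≡ 0
geomInv-nonmultiple m n eq with n % suc m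
geomInv-nonmultiple m n refl | suc _ = refl

geomInv-periodic : ∀ m n → geomInv m (suc m ℕ.+ n) ≡ geomInv m n
geomInv-periodic m n with n % suc m in eq
... | zero  = geomInv-multiple m (suc m ℕ.+ n)
  (trans (cong (_% suc m) (ℕ.+-comm (suc m) n)) (trans ([m+n]%n≡m%n n (suc m)) eq))
... | suc r = geomInv-nonmultiple m (suc m ℕ.+ n)
  (trans (cong (_% suc m) (ℕ.+-comm (suc m) n)) (trans ([m+n]%n≡m%n n (suc m)) eq))

-- The indicator of the multiples of m + 1 is periodic and, below the first period, nonzero only at
-- 0.
geomInv-unfold : ∀ m → ι (geomInv m) ≈ # 1 ⊕ q ↑ suc m ⊗ ι (geomInv m)
geomInv-unfold m = coeffs λ n → trans (at n) (sym (⊕-coeff (# 1) (q ↑ suc m ⊗ G) n))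
  where
  G = ι (geomInv m)
  at : ∀ n → G n ≡ const (+ 1) n ℤ.+ (q ↑ suc m ⊗ G) n
  at zero = sym (cong (λ z → + 1 ℤ.+ z) (q↑⊗-below (suc m) G 0 (s≤s z≤n)))
  at (suc n) with suc n ℕ.<? suc m
  ... | yes n<m = trans (cong +_ (geomInv-nonmultiple m (suc n) (m<n⇒m%n≡m n<m)))
                        (sym (trans (ℤ.+-identityˡ _) (q↑⊗-below (suc m) G (suc n) n<m)))
  ... | no  n≮m = subst (λ k → G k ≡ + 0 ℤ.+ (q ↑ suc m ⊗ G) k) (ℕ.m+[n∸m]≡n (ℕ.≮⇒≥ n≮m))
    (trans (cong +_ (geomInv-periodic m _))
           (sym (trans (ℤ.+-identityˡ _) (q↑⊗-shift (suc m) G (n ℕ.∸ m)))))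

qPoch⁻¹-suc : ∀ k → 1-q^ (suc k) ⊗ qPoch⁻¹ (suc k) ≈ qPoch⁻¹ k
qPoch⁻¹-suc k = begin
  1-q^ (suc k) ⊗ qPoch⁻¹ (suc k)
    ≈⟨ S.*-congˡ (ι-⊛ (prodInvUpTo k) (geomInv k)) ⟩
  1-q^ (suc k) ⊗ (qPoch⁻¹ k ⊗ G)
    ≈⟨ solve 3 (λ x r g → (con (+ 1) :- x) :* (r :* g) := r :* (g :- x :* g)) S.refl (q ↑ suc k) (qPoch⁻¹ k) G ⟩
  qPoch⁻¹ k ⊗ (G ⊕ ⊝ (q ↑ suc k ⊗ G))
    ≈⟨ S.*-congˡ (S.+-congʳ (geomInv-unfold k)) ⟩
  qPoch⁻¹ k ⊗ (# 1 ⊕ q ↑ suc k ⊗ G ⊕ ⊝ (q ↑ suc k ⊗ G))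
    ≈⟨ solve 2 (λ r y → r :* (con (+ 1) :+ y :- y) := r) S.refl (qPoch⁻¹ k) (q ↑ suc k ⊗ G) ⟩
  qPoch⁻¹ k ∎
  where G = ι (geomInv k)

qPoch-inverse : ∀ k → qPoch k ⊗ qPoch⁻¹ k ≈ # 1
qPoch-inverse zero    = S.trans (S.*-identityˡ _) ι-one
qPoch-inverse (suc k) = begin
  qPoch k ⊗ 1-q^ (suc k) ⊗ qPoch⁻¹ (suc k)   ≈⟨ S.*-assoc _ _ _ ⟩
  qPoch k ⊗ (1-q^ (suc k) ⊗ qPoch⁻¹ (suc k)) ≈⟨ S.*-congˡ (qPoch⁻¹-suc k) ⟩
  qPoch k ⊗ qPoch⁻¹ k                        ≈⟨ qPoch-inverse k ⟩
  # 1                                        ∎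

qPoch⁻¹→qPoch∞⁻¹ : ∀ n → qPoch⁻¹ n ≈[ n ] qPoch∞⁻¹
qPoch⁻¹→qPoch∞⁻¹ = diagonal-limit qPoch⁻¹ λ n →
  ≈[]-trans (≈[]-sym (⊗-1-q^ (qPoch⁻¹ (suc n)) n))
            (≈⇒≈[] (S.trans (S.*-comm _ _) (qPoch⁻¹-suc n)))

qPoch∞-inverse : qPoch∞ ⊗ qPoch∞⁻¹ ≈ # 1
qPoch∞-inverse = ≈[]⇒≈ λ n → ≈[]-trans
  (⊗-cong-≈[] (≈[]-sym (qPoch→qPoch∞ n)) (≈[]-sym (qPoch⁻¹→qPoch∞⁻¹ n)))
  (≈⇒≈[] (qPoch-inverse n))

-- A finite form of Jacobi's identity

-- The coefficients c_j of ∏ (1 - z⁻¹qᵏ) ∏ (1 - zqᵏ), with k ≤ n in both products but k ≥ 1 in the second,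
-- satisfy c_{-1-j} = -c_j; jacobi n j is c_j for j ≥ 0, and jacobiStep multiplies by
-- (1 - z⁻¹y)(1 - zy) with y = qⁿ⁺¹.  The derivative of the product at z = 1 is Σ (2j+1) c_j.
jacobiStep : ℤ⟦q⟧ → (ℕ → ℤ⟦q⟧) → ℕ → ℤ⟦q⟧
jacobiStep y h zero    = (# 1 ⊕ y ⊗ y ⊕ y) ⊗ h 0 ⊕ ⊝ (y ⊗ h 1)
jacobiStep y h (suc j) = (# 1 ⊕ y ⊗ y) ⊗ h (suc j) ⊕ ⊝ (y ⊗ (h j ⊕ h (suc (suc j))))

jacobi : ℕ → ℕ → ℤ⟦q⟧
jacobi zero    zero    = # 1
jacobi zero    (suc _) = # 0
jacobi (suc n) j       = jacobiStep (q ↑ suc n) (jacobi n) j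

odd : ℕ → ℤ⟦q⟧
odd zero    = # 1
odd (suc j) = odd j ⊕ # 2

oddSum : (ℕ → ℤ⟦q⟧) → ℕ → ℤ⟦q⟧
oddSum h zero    = odd 0 ⊗ h 0
oddSum h (suc K) = oddSum h K ⊕ odd (suc K) ⊗ h (suc K)

oddSum-step : ∀ y h K →
  oddSum (jacobiStep y h) K ⊕ y ⊗ (odd K ⊗ h (suc K)) ≈
  (# 1 ⊕ ⊝ y) ↑ 2 ⊗ oddSum h K ⊕ y ⊗ (odd (suc K) ⊗ h K)
oddSum-step y h zero = solve 3
  (λ y a b → con (+ 1) :* ((con (+ 1) :+ y :* y :+ y) :* a :- y :* b) :+ y :* (con (+ 1) :* b)
          := (con (+ 1) :- y) :^ 2 :* (con (+ 1) :* a) :+ y :* ((con (+ 1) :+ con (+ 2)) :* a))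
  S.refl y (h 0) (h 1)
oddSum-step y h (suc K) = begin
  W′ ⊕ c₁ ⊗ ((# 1 ⊕ y ⊗ y) ⊗ b ⊕ ⊝ (y ⊗ (a ⊕ d))) ⊕ y ⊗ (c₁ ⊗ d)
    ≈⟨ solve 6 (λ W′ y c a b d →
         W′ :+ (c :+ con (+ 2)) :* ((con (+ 1) :+ y :* y) :* b :- (y :* (a :+ d)))
           :+ y :* ((c :+ con (+ 2)) :* d)
         := (W′ :+ y :* (c :* b)) :- y :* (c :* b)
           :+ (c :+ con (+ 2)) :* ((con (+ 1) :+ y :* y) :* b :- y :* a))
       S.refl W′ y (odd K) a b d ⟩
  (W′ ⊕ y ⊗ (odd K ⊗ b)) ⊕ ⊝ (y ⊗ (odd K ⊗ b)) ⊕ c₁ ⊗ ((# 1 ⊕ y ⊗ y) ⊗ b ⊕ ⊝ (y ⊗ a))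
    ≈⟨ S.+-congʳ (S.+-congʳ (oddSum-step y h K)) ⟩
  ((# 1 ⊕ ⊝ y) ↑ 2 ⊗ W ⊕ y ⊗ (c₁ ⊗ a)) ⊕ ⊝ (y ⊗ (odd K ⊗ b)) ⊕ c₁ ⊗ ((# 1 ⊕ y ⊗ y) ⊗ b ⊕ ⊝ (y ⊗ a))
    ≈⟨ solve 5 (λ W y c a b →
         ((con (+ 1) :- y) :^ 2 :* W :+ y :* ((c :+ con (+ 2)) :* a)) :- y :* (c :* b)
           :+ (c :+ con (+ 2)) :* ((con (+ 1) :+ y :* y) :* b :- y :* a)
         := (con (+ 1) :- y) :^ 2 :* (W :+ (c :+ con (+ 2)) :* b)
           :+ y :* ((c :+ con (+ 2) :+ con (+ 2)) :* b))
       S.refl W y (odd K) a b ⟩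
  (# 1 ⊕ ⊝ y) ↑ 2 ⊗ (W ⊕ c₁ ⊗ b) ⊕ y ⊗ (odd (suc (suc K)) ⊗ b) ∎
  where
  W′ = oddSum (jacobiStep y h) K
  W  = oddSum h K
  c₁ = odd (suc K)
  a  = h K
  b  = h (suc K)
  d  = h (suc (suc K))

jacobi-vanishes : ∀ n j → n ℕ.< j → jacobi n j ≈ # 0
jacobi-vanishes zero    (suc j) _         = S.refl
jacobi-vanishes (suc n) (suc j) (s≤s n<j) = begin
  (# 1 ⊕ y ⊗ y) ⊗ jacobi n (suc j) ⊕ ⊝ (y ⊗ (jacobi n j ⊕ jacobi n (suc (suc j))))
    ≈⟨ S.+-cong (S.*-congˡ (jacobi-vanishes n (suc j) (ℕ.m≤n⇒m≤1+n n<j)))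
         (S.-‿cong (S.*-congˡ (S.+-cong (jacobi-vanishes n j n<j)
           (jacobi-vanishes n (suc (suc j)) (ℕ.m≤n⇒m≤1+n (ℕ.m≤n⇒m≤1+n n<j)))))) ⟩
  (# 1 ⊕ y ⊗ y) ⊗ # 0 ⊕ ⊝ (y ⊗ (# 0 ⊕ # 0))
    ≈⟨ solve 1 (λ y → (con (+ 1) :+ y :* y) :* con (+ 0) :- y :* (con (+ 0) :+ con (+ 0)) := con (+ 0)) S.refl y ⟩
  # 0 ∎
  where y = q ↑ suc n

-- The factor 1 - z⁻¹ vanishes at z = 1, so the derivative there is the product of all other
-- factors.
oddSum-jacobi : ∀ n → oddSum (jacobi n) n ≈ qPoch n ⊗ qPoch n
oddSum-jacobi zero    = solve 0 (con (+ 1) :* con (+ 1) := con (+ 1) :* con (+ 1)) S.refl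
oddSum-jacobi (suc n) = begin
  W′
    -- The sum is cut at n + 1, beyond the support of `jacobi n`, so both boundary terms of
    -- `oddSum-step` vanish; one of them is inserted here as a zero.
    ≈⟨ solve 3 (λ W y c → W := W :+ y :* (c :* con (+ 0))) S.refl W′ y (odd (suc n)) ⟩
  W′ ⊕ y ⊗ (odd (suc n) ⊗ # 0)
    ≈⟨ S.+-congˡ (S.*-congˡ (S.*-congˡ (S.sym (jacobi-vanishes n (suc (suc n)) (ℕ.m≤n⇒m≤1+n ℕ.≤-refl))))) ⟩
  W′ ⊕ y ⊗ (odd (suc n) ⊗ jacobi n (suc (suc n)))
    ≈⟨ oddSum-step y (jacobi n) (suc n) ⟩
  (# 1 ⊕ ⊝ y) ↑ 2 ⊗ (oddSum (jacobi n) n ⊕ odd (suc n) ⊗ jacobi n (suc n))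
    ⊕ y ⊗ (odd (suc (suc n)) ⊗ jacobi n (suc n))
    ≈⟨ S.+-cong (S.*-congˡ (S.+-cong (oddSum-jacobi n) (S.*-congˡ van))) (S.*-congˡ (S.*-congˡ van)) ⟩
  (# 1 ⊕ ⊝ y) ↑ 2 ⊗ (qPoch n ⊗ qPoch n ⊕ odd (suc n) ⊗ # 0) ⊕ y ⊗ (odd (suc (suc n)) ⊗ # 0)
    ≈⟨ solve 4 (λ y Q c d → (con (+ 1) :- y) :^ 2 :* (Q :* Q :+ c :* con (+ 0)) :+ y :* (d :* con (+ 0))
         := Q :* (con (+ 1) :- y) :* (Q :* (con (+ 1) :- y)))
       S.refl y (qPoch n) (odd (suc n)) (odd (suc (suc n))) ⟩
  qPoch (suc n) ⊗ qPoch (suc n) ∎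
  where
  y   = q ↑ suc n
  W′  = oddSum (jacobi (suc n)) (suc n)
  van = jacobi-vanishes n (suc n) ℕ.≤-refl

-- Closed form of the coefficients and Jacobi's identity in the limit

θ : ℕ → ℤ⟦q⟧
θ zero    = # 1
θ (suc j) = ⊝ (q ↑ suc j ⊗ θ j)

qPoch⁻¹-suc′ : ∀ k → qPoch⁻¹ k ≈ (# 1 ⊕ ⊝ (q ⊗ q ↑ k)) ⊗ qPoch⁻¹ (suc k)
qPoch⁻¹-suc′ k = S.sym (qPoch⁻¹-suc k)

-- c_j is θ j = (-1)ʲ q^(j(j+1)/2) times the q-binomial coefficient of 2n+1 over s = n - j.
JacobiClosed : ℕ → Set
JacobiClosed n = ∀ j s → s ℕ.+ j ≡ n →
  jacobi n j ≈ θ j ⊗ qPoch (suc (n ℕ.+ n)) ⊗ qPoch⁻¹ s ⊗ qPoch⁻¹ (suc (n ℕ.+ j))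

-- The next two lemmas shift j without lowering s, using 1/(q)_{s-1} = (1 - qˢ)/(q)_s, so that s = 0
-- (where both sides vanish) needs no separate case in the induction.
jacobi-closed⁺ : ∀ n → JacobiClosed n → ∀ j s → s ℕ.+ j ≡ n →
  jacobi n (suc j) ≈ θ (suc j) ⊗ qPoch (suc (n ℕ.+ n)) ⊗ (1-q^ s ⊗ qPoch⁻¹ s) ⊗ qPoch⁻¹ (suc (suc (n ℕ.+ j)))
jacobi-closed⁺ n ih j zero    refl = S.trans (jacobi-vanishes j (suc j) ℕ.≤-refl)
  (solve 4 (λ a b c d → con (+ 0) := a :* b :* ((con (+ 1) :- con (+ 1)) :* c) :* d) S.refl
    (θ (suc j)) (qPoch (suc (j ℕ.+ j))) (qPoch⁻¹ 0) (qPoch⁻¹ (suc (suc (j ℕ.+ j)))))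
jacobi-closed⁺ n ih j (suc s) eq = begin
  jacobi n (suc j)
    ≈⟨ ih (suc j) s (trans (ℕ.+-suc s j) eq) ⟩
  θ (suc j) ⊗ qPoch (suc (n ℕ.+ n)) ⊗ qPoch⁻¹ s ⊗ qPoch⁻¹ (suc (n ℕ.+ suc j))
    ≈⟨ S.*-cong (S.*-congˡ (S.sym (qPoch⁻¹-suc s))) (S.reflexive (cong (λ k → qPoch⁻¹ (suc k)) (ℕ.+-suc n j))) ⟩
  θ (suc j) ⊗ qPoch (suc (n ℕ.+ n)) ⊗ (1-q^ suc s ⊗ qPoch⁻¹ (suc s)) ⊗ qPoch⁻¹ (suc (suc (n ℕ.+ j))) ∎

jacobi-closed⁺⁺ : ∀ n → JacobiClosed n → ∀ j s → s ℕ.+ j ≡ n →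
  jacobi n (suc (suc j)) ≈ ⊝ (q ↑ suc j ⊗ θ (suc j)) ⊗ qPoch (suc (n ℕ.+ n))
    ⊗ ((q ⊕ ⊝ (q ↑ s)) ⊗ 1-q^ s ⊗ qPoch⁻¹ s) ⊗ qPoch⁻¹ (suc (suc (suc (n ℕ.+ j))))
jacobi-closed⁺⁺ n ih j zero    refl = S.trans (jacobi-vanishes j (suc (suc j)) (ℕ.m≤n⇒m≤1+n ℕ.≤-refl))
  (solve 5 (λ a b c d q → con (+ 0) := a :* b :* ((q :- con (+ 1)) :* (con (+ 1) :- con (+ 1)) :* c) :* d) S.refl
    (⊝ (q ↑ suc j ⊗ θ (suc j))) (qPoch (suc (j ℕ.+ j))) (qPoch⁻¹ 0) (qPoch⁻¹ (suc (suc (suc (j ℕ.+ j))))) q)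
jacobi-closed⁺⁺ n ih j (suc s) eq = begin
  jacobi n (suc (suc j))
    ≈⟨ jacobi-closed⁺ n ih (suc j) s (trans (ℕ.+-suc s j) eq) ⟩
  θ (suc (suc j)) ⊗ Q ⊗ (1-q^ s ⊗ qPoch⁻¹ s) ⊗ qPoch⁻¹ (suc (suc (n ℕ.+ suc j)))
    ≈⟨ S.*-cong (S.*-congˡ (S.*-congˡ (S.sym (qPoch⁻¹-suc s))))
         (S.reflexive (cong (λ k → qPoch⁻¹ (suc (suc k))) (ℕ.+-suc n j))) ⟩
  θ (suc (suc j)) ⊗ Q ⊗ (1-q^ s ⊗ (1-q^ suc s ⊗ r)) ⊗ r₂
    ≈⟨ solve 7 (λ q x w t Q r r₂ →
         :- (q :* x :* t) :* Q :* ((con (+ 1) :- w) :* ((con (+ 1) :- q :* w) :* r)) :* r₂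
         := :- (x :* t) :* Q :* ((q :- q :* w) :* (con (+ 1) :- q :* w) :* r) :* r₂)
       S.refl q (q ↑ suc j) (q ↑ s) (θ (suc j)) Q r r₂ ⟩
  ⊝ (q ↑ suc j ⊗ θ (suc j)) ⊗ Q ⊗ ((q ⊕ ⊝ (q ↑ suc s)) ⊗ 1-q^ suc s ⊗ r) ⊗ r₂ ∎
  where
  Q  = qPoch (suc (n ℕ.+ n))
  r  = qPoch⁻¹ (suc s)
  r₂ = qPoch⁻¹ (suc (suc (suc (n ℕ.+ j))))

qPoch-odd : ∀ n → qPoch (suc (suc n ℕ.+ suc n)) ≈
  qPoch (suc (n ℕ.+ n)) ⊗ (# 1 ⊕ ⊝ (q ⊗ (q ⊗ (q ↑ n ⊗ q ↑ n)))) ⊗ (# 1 ⊕ ⊝ (q ⊗ (q ⊗ (q ⊗ (q ↑ n ⊗ q ↑ n)))))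
qPoch-odd n rewrite ℕ.+-suc n n = S.*-cong
  (S.*-congˡ (S.+-congˡ (S.-‿cong (S.*-congˡ (S.*-congˡ (^-homo-* q n n))))))
  (S.+-congˡ (S.-‿cong (S.*-congˡ (S.*-congˡ (S.*-congˡ (^-homo-* q n n))))))

jacobi-closed : ∀ n → JacobiClosed n
jacobi-closed zero zero zero refl = begin
  # 1
    ≈⟨ S.*-identityˡ (# 1) ⟨
  # 1 ⊗ # 1
    ≈⟨ S.*-cong (qPoch-inverse 1) (qPoch-inverse 0) ⟨
  qPoch 1 ⊗ qPoch⁻¹ 1 ⊗ (# 1 ⊗ qPoch⁻¹ 0)
    ≈⟨ solve 3 (λ Q r r₀ → Q :* r :* (con (+ 1) :* r₀) := con (+ 1) :* Q :* r₀ :* r) S.refl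
         (qPoch 1) (qPoch⁻¹ 1) (qPoch⁻¹ 0) ⟩
  # 1 ⊗ qPoch 1 ⊗ qPoch⁻¹ 0 ⊗ qPoch⁻¹ 1 ∎
jacobi-closed (suc n) zero s eq with trans (sym (ℕ.+-identityʳ s)) eq
jacobi-closed (suc n) zero (suc n) eq | refl rewrite ℕ.+-identityʳ n = begin
  (# 1 ⊕ y ⊗ y ⊕ y) ⊗ jacobi n 0 ⊕ ⊝ (y ⊗ jacobi n 1)
    ≈⟨ S.+-cong
         (S.*-congˡ (S.trans (jacobi-closed n 0 n (ℕ.+-identityʳ n))
           (S.*-cong (S.*-congˡ (qPoch⁻¹-suc′ n))
             (S.trans (S.reflexive (cong (λ k → qPoch⁻¹ (suc k)) (ℕ.+-identityʳ n))) (qPoch⁻¹-suc′ (suc n))))))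
         (S.-‿cong (S.*-congˡ (S.trans (jacobi-closed⁺ n (jacobi-closed n) 0 n (ℕ.+-identityʳ n))
           (S.*-cong (S.*-congˡ (S.*-congˡ (qPoch⁻¹-suc′ n)))
             (S.reflexive (cong (λ k → qPoch⁻¹ (suc (suc k))) (ℕ.+-identityʳ n))))))) ⟩
  _
    ≈⟨ solve 5 (λ q x Q r r₂ → (con (+ 1) :+ (q :* x) :* (q :* x) :+ q :* x)
          :* (con (+ 1) :* Q :* ((con (+ 1) :- q :* x) :* r) :* ((con (+ 1) :- q :* (q :* x)) :* r₂))
          :- (q :* x) :* (:- (q :* con (+ 1) :* con (+ 1)) :* Q :* ((con (+ 1) :- x) :* ((con (+ 1) :- q :* x) :* r)) :* r₂)
          := con (+ 1) :* (Q :* (con (+ 1) :- q :* (q :* (x :* x))) :* (con (+ 1) :- q :* (q :* (q :* (x :* x))))) :* r :* r₂)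
        S.refl q (q ↑ n) (qPoch (suc (n ℕ.+ n))) (qPoch⁻¹ (suc n)) (qPoch⁻¹ (suc (suc n))) ⟩
  _
    ≈⟨ S.*-congʳ (S.*-congʳ (S.*-congˡ (qPoch-odd n))) ⟨
  # 1 ⊗ qPoch (suc (suc n ℕ.+ suc n)) ⊗ qPoch⁻¹ (suc n) ⊗ qPoch⁻¹ (suc (suc n)) ∎
  where y = q ↑ suc n
jacobi-closed (suc n) (suc j) s eq with ℕ.suc-injective (trans (sym (ℕ.+-suc s j)) eq)
... | s+j≡n rewrite ℕ.+-suc n j = begin
  (# 1 ⊕ y ⊗ y) ⊗ jacobi n (suc j) ⊕ ⊝ (y ⊗ (jacobi n j ⊕ jacobi n (suc (suc j))))
    ≈⟨ S.+-cong
         (S.*-cong (S.+-congˡ (S.*-cong y-eq y-eq))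
           (S.trans (jacobi-closed⁺ n (jacobi-closed n) j s s+j≡n) (S.*-congˡ r₁-eq)))
         (S.-‿cong (S.*-cong y-eq (S.+-cong
           (S.trans (jacobi-closed n j s s+j≡n) (S.*-congˡ (S.trans r₀-eq (S.*-congˡ r₁-eq))))
           (jacobi-closed⁺⁺ n (jacobi-closed n) j s s+j≡n)))) ⟩
  _
    -- With x = qʲ, w = qˢ and y = qⁿ⁺¹ = q w x, every term now carries the same inverse factors `r`
    -- and `r₂`, and the recursion is a polynomial identity.
    ≈⟨ solve 7 (λ q x w t Q r r₂ →
         (con (+ 1) :+ (q :* (w :* x)) :* (q :* (w :* x)))
           :* (:- (q :* x :* t) :* Q :* ((con (+ 1) :- w) :* r) :* ((con (+ 1) :- q :* (q :* (q :* (w :* x :* x)))) :* r₂))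
         :- (q :* (w :* x)) :* (t :* Q :* r :* ((con (+ 1) :- q :* (q :* (w :* x :* x))) :* ((con (+ 1) :- q :* (q :* (q :* (w :* x :* x)))) :* r₂))
            :+ :- (q :* x :* :- (q :* x :* t)) :* Q :* ((q :- w) :* (con (+ 1) :- w) :* r) :* r₂)
         := :- (q :* x :* t) :* (Q :* (con (+ 1) :- q :* (q :* (w :* x :* (w :* x)))) :* (con (+ 1) :- q :* (q :* (q :* (w :* x :* (w :* x)))))) :* r :* r₂)
       S.refl q (q ↑ j) (q ↑ s) (θ j) (qPoch (suc (n ℕ.+ n))) (qPoch⁻¹ s) r₂ ⟩
  _
    ≈⟨ S.*-congʳ (S.*-congʳ (S.*-congˡ (S.trans (qPoch-odd n) (S.*-cong
         (S.*-congˡ (S.+-congˡ (S.-‿cong (S.*-congˡ (S.*-congˡ (S.*-cong n-eq n-eq))))))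
         (S.+-congˡ (S.-‿cong (S.*-congˡ (S.*-congˡ (S.*-congˡ (S.*-cong n-eq n-eq)))))))))) ⟨
  θ (suc j) ⊗ qPoch (suc (suc n ℕ.+ suc n)) ⊗ qPoch⁻¹ s ⊗ r₂ ∎
  where
  y    = q ↑ suc n
  r₂   = qPoch⁻¹ (suc (suc (suc (n ℕ.+ j))))
  n-eq : q ↑ n ≈ q ↑ s ⊗ q ↑ j
  n-eq = S.trans (S.reflexive (cong (q ↑_) (sym s+j≡n))) (^-homo-* q s j)
  y-eq = S.*-congˡ {q} n-eq
  N-eq : q ↑ (n ℕ.+ j) ≈ q ↑ s ⊗ q ↑ j ⊗ q ↑ j
  N-eq = S.trans (^-homo-* q n j) (S.*-congʳ n-eq)
  r₁-eq = S.trans (qPoch⁻¹-suc′ (suc (suc (n ℕ.+ j))))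
    (S.*-congʳ (S.+-congˡ {# 1} (S.-‿cong (S.*-congˡ {q} (S.*-congˡ {q} (S.*-congˡ {q} N-eq))))))
  r₀-eq = S.trans (qPoch⁻¹-suc′ (suc (n ℕ.+ j)))
    (S.*-congʳ (S.+-congˡ {# 1} (S.-‿cong (S.*-congˡ {q} (S.*-congˡ {q} N-eq)))))

-- Each unfolding of `θ` supplies at least one factor q. The true gain is j(j+1)/2, but j suffices.
θ-gain : ∀ j {f g n} → f ≈[ n ] g → θ j ⊗ f ≈[ j ℕ.+ n ] θ j ⊗ g
θ-gain zero    p = ⊗-cong-≈[] (≈[]-refl {# 1}) p
θ-gain (suc j) {f} {g} p = ≈[]-trans (≈⇒≈[] (shuffle f))
  (≈[]-trans (q⊗-cong-≈[] (⊗-cong-≈[] (≈[]-refl {⊝ (q ↑ j)}) (θ-gain j p)))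
             (≈⇒≈[] (S.sym (shuffle g))))
  where
  shuffle : ∀ f → θ (suc j) ⊗ f ≈ q ⊗ (⊝ (q ↑ j) ⊗ (θ j ⊗ f))
  shuffle f = solve 4 (λ q x t f → :- (q :* x :* t) :* f := q :* (:- x :* (t :* f))) S.refl q (q ↑ j) (θ j) f

-- Because of 1/(q)_{n-j}, the cofactor of `θ j` is known to be 1 only up to order n - j; `θ-gain`
-- makes up the missing j orders.
qPoch∞-jacobi : ∀ n j → j ℕ.≤ n → qPoch∞ ⊗ jacobi n j ≈[ n ] θ j
qPoch∞-jacobi n j j≤n = subst (λ m → qPoch∞ ⊗ jacobi n j ≈[ m ] θ j) (ℕ.m+[n∸m]≡n j≤n)
  (≈[]-trans (≈⇒≈[] (S.trans (S.*-congˡ (jacobi-closed n j s (ℕ.m∸n+n≡m j≤n)))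
      (solve 5 (λ e t Q r r′ → e :* (t :* Q :* r :* r′) := t :* (e :* Q :* r :* r′)) S.refl
        qPoch∞ (θ j) Q r r′)))
    (≈[]-trans (θ-gain j tends-to-1) (≈⇒≈[] (S.*-identityʳ (θ j)))))
  where
  s  = n ℕ.∸ j
  Q  = qPoch (suc (n ℕ.+ n))
  r  = qPoch⁻¹ s
  r′ = qPoch⁻¹ (suc (n ℕ.+ j))
  s≤n : s ℕ.≤ n
  s≤n = ℕ.m∸n≤m n j
  tends-to-1 : qPoch∞ ⊗ Q ⊗ r ⊗ r′ ≈[ s ] # 1
  tends-to-1 = ≈[]-trans
    (⊗-cong-≈[]
      (⊗-cong-≈[]
        (⊗-cong-≈[] (≈[]-refl {qPoch∞})
          (≈[]-weaken (ℕ.m≤n⇒m≤1+n (ℕ.≤-trans s≤n (ℕ.m≤m+n n n))) (qPoch→qPoch∞ (suc (n ℕ.+ n)))))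
        (qPoch⁻¹→qPoch∞⁻¹ s))
      (≈[]-weaken (ℕ.m≤n⇒m≤1+n (ℕ.≤-trans s≤n (ℕ.m≤m+n n j))) (qPoch⁻¹→qPoch∞⁻¹ (suc (n ℕ.+ j)))))
    (≈⇒≈[] (S.trans (solve 2 (λ e p → e :* e :* p :* p := (e :* p) :* (e :* p)) S.refl qPoch∞ qPoch∞⁻¹)
      (S.trans (S.*-cong qPoch∞-inverse qPoch∞-inverse) (S.*-identityˡ (# 1)))))

oddSum-cong : ∀ {e g h n} K → (∀ j → j ℕ.≤ K → e ⊗ g j ≈[ n ] h j) → e ⊗ oddSum g K ≈[ n ] oddSum h K
oddSum-cong {e} {g} zero p = ≈[]-trans
  (≈⇒≈[] (solve 2 (λ e g → e :* (con (+ 1) :* g) := con (+ 1) :* (e :* g)) S.refl e (g 0)))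
  (⊗-cong-≈[] (≈[]-refl {# 1}) (p 0 z≤n))
oddSum-cong {e} {g} (suc K) p = ≈[]-trans
  (≈⇒≈[] (solve 4 (λ e w c g → e :* (w :+ c :* g) := e :* w :+ c :* (e :* g)) S.refl
    e (oddSum g K) (odd (suc K)) (g (suc K))))
  (⊕-cong-≈[] (oddSum-cong K (λ j j≤K → p j (ℕ.m≤n⇒m≤1+n j≤K)))
              (⊗-cong-≈[] (≈[]-refl {odd (suc K)}) (p (suc K) ℕ.≤-refl)))

-- Two of the three factors E are replaced by (q)_n and expanded by `oddSum-jacobi`; the third turns
-- each `jacobi n j` into `θ j`.
jacobi-identity : ∀ n → qPoch∞ ↑ 3 ≈[ n ] oddSum θ n
jacobi-identity n = ≈[]-trans
  (≈⇒≈[] (solve 1 (λ e → e :^ 3 := e :* (e :* e)) S.refl qPoch∞))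
  (≈[]-trans
    (⊗-cong-≈[] (≈[]-refl {qPoch∞})
      (≈[]-trans
        (⊗-cong-≈[] (≈[]-sym (qPoch→qPoch∞ n)) (≈[]-sym (qPoch→qPoch∞ n)))
        (≈⇒≈[] (S.sym (oddSum-jacobi n)))))
    (oddSum-cong n (qPoch∞-jacobi n)))

-- Residue classes modulo 3

-- H f is f(q³).
H : ℤ⟦q⟧ → ℤ⟦q⟧
H f 0                   = f 0
H f 1                   = + 0
H f 2                   = + 0
H f (suc (suc (suc n))) = H (tl f) n

U : Fin 3 → ℤ⟦q⟧ → ℤ⟦q⟧
U r f n = f (n ℕ.* 3 ℕ.+ toℕ r)

U-cong : ∀ r {f g} → f ≈ g → U r f ≈ U r g
U-cong r p = coeffs λ n → coeff p (n ℕ.* 3 ℕ.+ toℕ r)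

U-⊕ : ∀ r f g → U r (f ⊕ g) ≈ U r f ⊕ U r g
U-⊕ r f g = coeffs λ n → trans (⊕-coeff f g (n ℕ.* 3 ℕ.+ toℕ r)) (sym (⊕-coeff (U r f) (U r g) n))

U-⊝ : ∀ r f → U r (⊝ f) ≈ ⊝ U r f
U-⊝ r f = coeffs λ n → trans (⊝-coeff f (n ℕ.* 3 ℕ.+ toℕ r)) (sym (⊝-coeff (U r f) n))

U-ext : ∀ {f g} → U 0F f ≈ U 0F g → U 1F f ≈ U 1F g → U 2F f ≈ U 2F g → f ≈ g
U-ext {f} {g} p₀ p₁ p₂ = coeffs (go f g (coeff p₀) (coeff p₁) (coeff p₂))
  where
  go : ∀ f g → (∀ n → U 0F f n ≡ U 0F g n) → (∀ n → U 1F f n ≡ U 1F g n) →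
       (∀ n → U 2F f n ≡ U 2F g n) → ∀ n → f n ≡ g n
  go f g p₀ p₁ p₂ 0 = p₀ 0
  go f g p₀ p₁ p₂ 1 = p₁ 0
  go f g p₀ p₁ p₂ 2 = p₂ 0
  go f g p₀ p₁ p₂ (suc (suc (suc n))) = go (λ i → f (3 ℕ.+ i)) (λ i → g (3 ℕ.+ i))
    (λ i → p₀ (suc i)) (λ i → p₁ (suc i)) (λ i → p₂ (suc i)) n

U₀-H : ∀ f → U 0F (H f) ≈ f
U₀-H f = coeffs (go f)
  where
  go : ∀ f n → H f (n ℕ.* 3 ℕ.+ 0) ≡ f n
  go f zero    = refl
  go f (suc n) = go (tl f) n

U-suc-H : ∀ r f → U (suc r) (H f) ≈ # 0
U-suc-H r f = coeffs λ n → trans (go r f n) (sym (const₀-coeff n))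
  where
  go : ∀ (r : Fin 2) f n → H f (n ℕ.* 3 ℕ.+ suc (toℕ r)) ≡ + 0
  go 0F f zero    = refl
  go 1F f zero    = refl
  go r  f (suc n) = go r (tl f) n

H⊗-coeff₁ : ∀ f g → (H f ⊗ g) 1 ≡ f 0 ℤ.* g 1
H⊗-coeff₁ f g = trans (⊗-coeff₁ (H f) g 0)
  (trans (cong (λ z → f 0 ℤ.* g 1 ℤ.+ z) (⊗-coeff₀ (tl (H f)) g)) (ℤ.+-identityʳ _))

H⊗-coeff₂ : ∀ f g → (H f ⊗ g) 2 ≡ f 0 ℤ.* g 2
H⊗-coeff₂ f g = trans (⊗-coeff₁ (H f) g 1)
  (trans (cong (λ z → f 0 ℤ.* g 2 ℤ.+ z)
    (trans (⊗-coeff₁ (tl (H f)) g 0) (trans (ℤ.+-identityˡ _) (⊗-coeff₀ (tl (tl (H f))) g))))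
    (ℤ.+-identityʳ _))

H⊗-coeff₃ : ∀ f g n → (H f ⊗ g) (3 ℕ.+ n) ≡ f 0 ℤ.* g (3 ℕ.+ n) ℤ.+ (H (tl f) ⊗ g) n
H⊗-coeff₃ f g n = trans (⊗-coeff₁ (H f) g (2 ℕ.+ n))
  (cong (λ z → f 0 ℤ.* g (3 ℕ.+ n) ℤ.+ z)
    (trans (⊗-coeff₁ (tl (H f)) g (1 ℕ.+ n)) (trans (ℤ.+-identityˡ _)
      (trans (⊗-coeff₁ (tl (tl (H f))) g n) (ℤ.+-identityˡ _)))))

-- The projection formula: series in q³ are scalars for the extraction of a residue class.
U-H⊗ : ∀ r f g → U r (H f ⊗ g) ≈ f ⊗ U r g
U-H⊗ r f g = coeffs (go f)
  where
  base : ∀ r f → (H f ⊗ g) (toℕ r) ≡ f 0 ℤ.* g (toℕ r)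
  base 0F f = ⊗-coeff₀ (H f) g
  base 1F f = H⊗-coeff₁ f g
  base 2F f = H⊗-coeff₂ f g
  go : ∀ f n → (H f ⊗ g) (n ℕ.* 3 ℕ.+ toℕ r) ≡ (f ⊗ U r g) n
  go f zero    = trans (base r f) (sym (⊗-coeff₀ f (U r g)))
  go f (suc n) = trans (H⊗-coeff₃ f g (n ℕ.* 3 ℕ.+ toℕ r))
    (trans (cong (λ z → f 0 ℤ.* U r g (suc n) ℤ.+ z) (go (tl f) n)) (sym (⊗-coeff₁ f (U r g) n)))

U₀-q⊗ : ∀ f → U 0F (q ⊗ f) ≈ q ⊗ U 2F f
U₀-q⊗ f = coeffs λ where
  zero    → trans (q⊗-zero f) (sym (q⊗-zero (U 2F f)))
  (suc n) → trans (q⊗-suc f (2 ℕ.+ (n ℕ.* 3 ℕ.+ 0)))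
    (trans (cong f (trans (cong (2 ℕ.+_) (ℕ.+-identityʳ (n ℕ.* 3))) (ℕ.+-comm 2 (n ℕ.* 3))))
           (sym (q⊗-suc (U 2F f) n)))

U₁-q⊗ : ∀ f → U 1F (q ⊗ f) ≈ U 0F f
U₁-q⊗ f = coeffs λ n → trans (cong (q ⊗ f) (ℕ.+-suc (n ℕ.* 3) 0)) (q⊗-suc f (n ℕ.* 3 ℕ.+ 0))

U₂-q⊗ : ∀ f → U 2F (q ⊗ f) ≈ U 1F f
U₂-q⊗ f = coeffs λ n → trans (cong (q ⊗ f) (ℕ.+-suc (n ℕ.* 3) 1)) (q⊗-suc f (n ℕ.* 3 ℕ.+ 1))

H-cong : ∀ {f g} → f ≈ g → H f ≈ H g
H-cong p = coeffs (go (coeff p))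
  where
  go : ∀ {f g} → (∀ n → f n ≡ g n) → ∀ n → H f n ≡ H g n
  go p 0 = p 0
  go p 1 = refl
  go p 2 = refl
  go p (suc (suc (suc n))) = go (λ i → p (suc i)) n

H-cong-≈[] : ∀ {f g n} → f ≈[ n ] g → H f ≈[ n ] H g
H-cong-≈[] p i i≤n = go i (λ j j≤i → p j (ℕ.≤-trans j≤i i≤n))
  where
  go : ∀ {f g} i → (∀ j → j ℕ.≤ i → f j ≡ g j) → H f i ≡ H g i
  go 0 p = p 0 z≤n
  go 1 p = refl
  go 2 p = refl
  go (suc (suc (suc i))) p = go i (λ j j≤i → p (suc j) (s≤s (ℕ.m≤n⇒m≤1+n (ℕ.m≤n⇒m≤1+n j≤i))))

H-const : ∀ c → H (const c) ≈ const c
H-const c = coeffs (go c)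
  where
  zeros : ∀ n → H (λ _ → + 0) n ≡ + 0
  zeros 0 = refl
  zeros 1 = refl
  zeros 2 = refl
  zeros (suc (suc (suc n))) = zeros n
  go : ∀ c n → H (const c) n ≡ const c n
  go c 0 = refl
  go c 1 = refl
  go c 2 = refl
  go c (suc (suc (suc n))) = zeros n

U₀-const : ∀ c → U 0F (const c) ≈ const c
U₀-const c = S.trans (U-cong 0F (S.sym (H-const c))) (U₀-H (const c))

U-suc-const : ∀ r c → U (suc r) (const c) ≈ # 0
U-suc-const r c = S.trans (U-cong (suc r) (S.sym (H-const c))) (U-suc-H r (const c))

H-⊕ : ∀ f g → H (f ⊕ g) ≈ H f ⊕ H g
H-⊕ f g = U-ext
  (S.trans (U₀-H (f ⊕ g)) (S.sym (S.trans (U-⊕ 0F (H f) (H g)) (S.+-cong (U₀-H f) (U₀-H g)))))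
  (S.trans (U-suc-H 0F (f ⊕ g)) (S.sym (S.trans (U-⊕ 1F (H f) (H g)) (S.trans (S.+-cong (U-suc-H 0F f) (U-suc-H 0F g)) (S.+-identityˡ (# 0))))))
  (S.trans (U-suc-H 1F (f ⊕ g)) (S.sym (S.trans (U-⊕ 2F (H f) (H g)) (S.trans (S.+-cong (U-suc-H 1F f) (U-suc-H 1F g)) (S.+-identityˡ (# 0))))))

H-⊗ : ∀ f g → H (f ⊗ g) ≈ H f ⊗ H g
H-⊗ f g = U-ext
  (S.trans (U₀-H (f ⊗ g)) (S.sym (S.trans (U-H⊗ 0F f (H g)) (S.*-congˡ (U₀-H g)))))
  (S.trans (U-suc-H 0F (f ⊗ g)) (S.sym (S.trans (U-H⊗ 1F f (H g)) (S.trans (S.*-congˡ (U-suc-H 0F g)) (S.zeroʳ f)))))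
  (S.trans (U-suc-H 1F (f ⊗ g)) (S.sym (S.trans (U-H⊗ 2F f (H g)) (S.trans (S.*-congˡ (U-suc-H 1F g)) (S.zeroʳ f)))))

H-⊝ : ∀ f → H (⊝ f) ≈ ⊝ H f
H-⊝ f = begin
  H (⊝ f)               ≈⟨ H-cong (solve 1 (λ f → :- f := con -[1+ 0 ] :* f) S.refl f) ⟩
  H (const -[1+ 0 ] ⊗ f) ≈⟨ H-⊗ (const -[1+ 0 ]) f ⟩
  H (const -[1+ 0 ]) ⊗ H f ≈⟨ S.*-congʳ (H-const -[1+ 0 ]) ⟩
  const -[1+ 0 ] ⊗ H f   ≈⟨ solve 1 (λ f → con -[1+ 0 ] :* f := :- f) S.refl (H f) ⟩
  ⊝ H f                 ∎

H-↑ : ∀ f n → H (f ↑ n) ≈ H f ↑ n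
H-↑ f zero    = H-const (+ 1)
H-↑ f (suc n) = S.trans (H-⊗ f (f ↑ n)) (S.*-congˡ (H-↑ f n))

-- Horner form of a(q³) + q b(q³) + q² c(q³), so that the rules for U of `q ⊗ f` peel off one
-- component at a time.
U-parts : ℤ⟦q⟧ → ℤ⟦q⟧ → ℤ⟦q⟧ → ℤ⟦q⟧
U-parts a b c = H a ⊕ q ⊗ (H b ⊕ q ⊗ H c)

U₀-parts : ∀ a b c → U 0F (U-parts a b c) ≈ a
U₀-parts a b c = begin
  U 0F (H a ⊕ q ⊗ (H b ⊕ q ⊗ H c)) ≈⟨ U-⊕ 0F (H a) _ ⟩
  U 0F (H a) ⊕ U 0F (q ⊗ (H b ⊕ q ⊗ H c)) ≈⟨ S.+-cong (U₀-H a) (U₀-q⊗ (H b ⊕ q ⊗ H c)) ⟩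
  a ⊕ q ⊗ U 2F (H b ⊕ q ⊗ H c)
    ≈⟨ S.+-congˡ (S.*-congˡ (S.trans (U-⊕ 2F (H b) _) (S.+-cong (U-suc-H 1F b) (S.trans (U₂-q⊗ (H c)) (U-suc-H 0F c))))) ⟩
  a ⊕ q ⊗ (# 0 ⊕ # 0) ≈⟨ solve 2 (λ a q → a :+ q :* (con (+ 0) :+ con (+ 0)) := a) S.refl a q ⟩
  a ∎

U₁-parts : ∀ a b c → U 1F (U-parts a b c) ≈ b
U₁-parts a b c = begin
  U 1F (H a ⊕ q ⊗ (H b ⊕ q ⊗ H c)) ≈⟨ U-⊕ 1F (H a) _ ⟩
  U 1F (H a) ⊕ U 1F (q ⊗ (H b ⊕ q ⊗ H c)) ≈⟨ S.+-cong (U-suc-H 0F a) (U₁-q⊗ (H b ⊕ q ⊗ H c)) ⟩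
  # 0 ⊕ U 0F (H b ⊕ q ⊗ H c)
    ≈⟨ S.+-congˡ (S.trans (U-⊕ 0F (H b) _) (S.+-cong (U₀-H b) (S.trans (U₀-q⊗ (H c)) (S.*-congˡ (U-suc-H 1F c))))) ⟩
  # 0 ⊕ (b ⊕ q ⊗ # 0) ≈⟨ solve 2 (λ b q → con (+ 0) :+ (b :+ q :* con (+ 0)) := b) S.refl b q ⟩
  b ∎

U₂-parts : ∀ a b c → U 2F (U-parts a b c) ≈ c
U₂-parts a b c = begin
  U 2F (H a ⊕ q ⊗ (H b ⊕ q ⊗ H c)) ≈⟨ U-⊕ 2F (H a) _ ⟩
  U 2F (H a) ⊕ U 2F (q ⊗ (H b ⊕ q ⊗ H c)) ≈⟨ S.+-cong (U-suc-H 1F a) (U₂-q⊗ (H b ⊕ q ⊗ H c)) ⟩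
  # 0 ⊕ U 1F (H b ⊕ q ⊗ H c)
    ≈⟨ S.+-congˡ (S.trans (U-⊕ 1F (H b) _) (S.+-cong (U-suc-H 0F b) (S.trans (U₁-q⊗ (H c)) (U₀-H c)))) ⟩
  # 0 ⊕ (# 0 ⊕ c) ≈⟨ solve 1 (λ c → con (+ 0) :+ (con (+ 0) :+ c) := c) S.refl c ⟩
  c ∎

U-parts-complete : ∀ f → f ≈ U-parts (U 0F f) (U 1F f) (U 2F f)
U-parts-complete f = U-ext (S.sym (U₀-parts _ _ _)) (S.sym (U₁-parts _ _ _)) (S.sym (U₂-parts _ _ _))

U-parts-cong : ∀ {a a′ b b′ c c′} → a ≈ a′ → b ≈ b′ → c ≈ c′ → U-parts a b c ≈ U-parts a′ b′ c′
U-parts-cong p r s = S.+-cong (H-cong p) (S.*-congˡ (S.+-cong (H-cong r) (S.*-congˡ (H-cong s))))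

H-q : H q ≈ q ↑ 3
H-q = U-ext
  (S.trans (U₀-H q) (S.sym (S.trans (U₀-q⊗ (q ↑ 2)) (S.trans (S.*-congˡ (S.trans (U₂-q⊗ (q ↑ 1)) (S.trans (U₁-q⊗ (# 1)) (U₀-const (+ 1))))) (S.*-identityʳ q)))))
  (S.trans (U-suc-H 0F q) (S.sym (S.trans (U₁-q⊗ (q ↑ 2)) (S.trans (U₀-q⊗ (q ↑ 1)) (S.trans (S.*-congˡ (S.trans (U₂-q⊗ (# 1)) (U-suc-const 0F (+ 1)))) (S.zeroʳ q))))))
  (S.trans (U-suc-H 1F q) (S.sym (S.trans (U₂-q⊗ (q ↑ 2)) (S.trans (U₁-q⊗ (q ↑ 1)) (S.trans (U₀-q⊗ (# 1)) (S.trans (S.*-congˡ (U-suc-const 1F (+ 1))) (S.zeroʳ q)))))))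

U-parts-⊗ : ∀ a b c a′ b′ c′ → U-parts a b c ⊗ U-parts a′ b′ c′ ≈
  U-parts (a ⊗ a′ ⊕ q ⊗ (b ⊗ c′ ⊕ c ⊗ b′)) (a ⊗ b′ ⊕ b ⊗ a′ ⊕ q ⊗ (c ⊗ c′)) (a ⊗ c′ ⊕ b ⊗ b′ ⊕ c ⊗ a′)
U-parts-⊗ a b c a′ b′ c′ = begin
  U-parts a b c ⊗ U-parts a′ b′ c′
    ≈⟨ solve 7 (λ q a b c a′ b′ c′ → (a :+ q :* (b :+ q :* c)) :* (a′ :+ q :* (b′ :+ q :* c′))
         := a :* a′ :+ q :^ 3 :* (b :* c′ :+ c :* b′)
           :+ q :* (a :* b′ :+ b :* a′ :+ q :^ 3 :* (c :* c′) :+ q :* (a :* c′ :+ b :* b′ :+ c :* a′)))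
       S.refl q (H a) (H b) (H c) (H a′) (H b′) (H c′) ⟩
  _
    ≈⟨ S.+-cong
         (hom₂ a a′ (lift-q (hom₂′ b c′ c b′)))
         (S.*-congˡ (S.+-cong (S.trans (S.+-cong (hom₂′ a b′ b a′) (lift-q (S.sym (H-⊗ c c′)))) (S.sym (H-⊕ _ _)))
           (S.*-congˡ (hom₂″ a c′ b b′ c a′)))) ⟩
  U-parts (a ⊗ a′ ⊕ q ⊗ (b ⊗ c′ ⊕ c ⊗ b′)) (a ⊗ b′ ⊕ b ⊗ a′ ⊕ q ⊗ (c ⊗ c′)) (a ⊗ c′ ⊕ b ⊗ b′ ⊕ c ⊗ a′) ∎
  where
  lift-q : ∀ {x y} → x ≈ H y → q ↑ 3 ⊗ x ≈ H (q ⊗ y)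
  lift-q p = S.trans (S.*-cong (S.sym H-q) p) (S.sym (H-⊗ q _))
  hom₂ : ∀ x y {u v} → u ≈ H v → H x ⊗ H y ⊕ u ≈ H (x ⊗ y ⊕ v)
  hom₂ x y p = S.trans (S.+-cong (S.sym (H-⊗ x y)) p) (S.sym (H-⊕ _ _))
  hom₂′ : ∀ x y u v → H x ⊗ H y ⊕ H u ⊗ H v ≈ H (x ⊗ y ⊕ u ⊗ v)
  hom₂′ x y u v = hom₂ x y (S.sym (H-⊗ u v))
  hom₂″ : ∀ x y u v s t → H x ⊗ H y ⊕ H u ⊗ H v ⊕ H s ⊗ H t ≈ H (x ⊗ y ⊕ u ⊗ v ⊕ s ⊗ t)
  hom₂″ x y u v s t = S.trans (S.+-cong (hom₂′ x y u v) (S.sym (H-⊗ s t))) (S.sym (H-⊕ _ _))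

-- The norm from ℤ⟦q⟧ to ℤ⟦q³⟧

-- ∏ f(ωʲq) over the cube roots of unity is H (norm a b c) when f = U-parts a b c.
norm : ℤ⟦q⟧ → ℤ⟦q⟧ → ℤ⟦q⟧ → ℤ⟦q⟧
norm a b c = a ↑ 3 ⊕ q ⊗ b ↑ 3 ⊕ q ↑ 2 ⊗ c ↑ 3 ⊕ ⊝ (# 3 ⊗ q ⊗ a ⊗ b ⊗ c)

-- `norm a b c` is the determinant of multiplication by a + bx + cx² where x³ = q. The arguments on
-- the left are the components of a product, as in `U-parts-⊗`.
norm-⊗ : ∀ a b c a′ b′ c′ →
  norm (a ⊗ a′ ⊕ q ⊗ (b ⊗ c′ ⊕ c ⊗ b′)) (a ⊗ b′ ⊕ b ⊗ a′ ⊕ q ⊗ (c ⊗ c′)) (a ⊗ c′ ⊕ b ⊗ b′ ⊕ c ⊗ a′)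
  ≈ norm a b c ⊗ norm a′ b′ c′
norm-⊗ = solve 7 (λ q a b c a′ b′ c′ →
  N q (a :* a′ :+ q :* (b :* c′ :+ c :* b′)) (a :* b′ :+ b :* a′ :+ q :* (c :* c′)) (a :* c′ :+ b :* b′ :+ c :* a′)
  := N q a b c :* N q a′ b′ c′) S.refl q
  where
  N = λ q a b c → a :^ 3 :+ q :* b :^ 3 :+ q :^ 2 :* c :^ 3 :- con (+ 3) :* q :* a :* b :* c

norm-cong : ∀ {a a′ b b′ c c′} → a ≈ a′ → b ≈ b′ → c ≈ c′ → norm a b c ≈ norm a′ b′ c′
norm-cong p r s = S.+-cong
  (S.+-cong (S.+-cong (^-congˡ 3 p) (S.*-congˡ (^-congˡ 3 r))) (S.*-congˡ (^-congˡ 3 s)))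
  (S.-‿cong (S.*-cong (S.*-cong (S.*-congˡ p) r) s))

Norm : ℤ⟦q⟧ → ℤ⟦q⟧
Norm f = norm (U 0F f) (U 1F f) (U 2F f)

Norm-cong : ∀ {f g} → f ≈ g → Norm f ≈ Norm g
Norm-cong p = norm-cong (U-cong 0F p) (U-cong 1F p) (U-cong 2F p)

Norm-parts : ∀ a b c → Norm (U-parts a b c) ≈ norm a b c
Norm-parts a b c = norm-cong (U₀-parts a b c) (U₁-parts a b c) (U₂-parts a b c)

Norm-⊗ : ∀ f g → Norm (f ⊗ g) ≈ Norm f ⊗ Norm g
Norm-⊗ f g = S.trans
  (Norm-cong (S.trans (S.*-cong (U-parts-complete f) (U-parts-complete g)) (U-parts-⊗ _ _ _ _ _ _)))
  (S.trans (Norm-parts _ _ _) (norm-⊗ _ _ _ _ _ _))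

U-cong-≈[] : ∀ r {f g} n → f ≈[ n ℕ.* 3 ℕ.+ 2 ] g → U r f ≈[ n ] U r g
U-cong-≈[] r n p i i≤n = p (i ℕ.* 3 ℕ.+ toℕ r) (ℕ.+-mono-≤ (ℕ.*-monoˡ-≤ 3 i≤n) (Fin.toℕ≤pred[n] r))

↑-cong-≈[] : ∀ k {f g n} → f ≈[ n ] g → f ↑ k ≈[ n ] g ↑ k
↑-cong-≈[] zero    p = ≈[]-refl
↑-cong-≈[] (suc k) p = ⊗-cong-≈[] p (↑-cong-≈[] k p)

Norm-cong-≈[] : ∀ {f g} n → f ≈[ n ℕ.* 3 ℕ.+ 2 ] g → Norm f ≈[ n ] Norm g
Norm-cong-≈[] n p = ⊕-cong-≈[]
  (⊕-cong-≈[]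
    (⊕-cong-≈[] (↑-cong-≈[] 3 p₀) (⊗-cong-≈[] (≈[]-refl {q}) (↑-cong-≈[] 3 p₁)))
    (⊗-cong-≈[] (≈[]-refl {q ↑ 2}) (↑-cong-≈[] 3 p₂)))
  (⊝-cong-≈[] (⊗-cong-≈[] (⊗-cong-≈[] (⊗-cong-≈[] (≈[]-refl {# 3 ⊗ q}) p₀) p₁) p₂))
  where
  p₀ = U-cong-≈[] 0F n p
  p₁ = U-cong-≈[] 1F n p
  p₂ = U-cong-≈[] 2F n p

q↑[k*3] : ∀ k → q ↑ (k ℕ.* 3) ≈ H (q ↑ k)
q↑[k*3] zero    = S.sym (H-const (+ 1))
q↑[k*3] (suc k) = begin
  q ⊗ (q ⊗ (q ⊗ q ↑ (k ℕ.* 3)))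
    ≈⟨ solve 2 (λ q y → q :* (q :* (q :* y)) := q :^ 3 :* y) S.refl q (q ↑ (k ℕ.* 3)) ⟩
  q ↑ 3 ⊗ q ↑ (k ℕ.* 3) ≈⟨ S.*-cong (S.sym H-q) (q↑[k*3] k) ⟩
  H q ⊗ H (q ↑ k)       ≈⟨ H-⊗ q (q ↑ k) ⟨
  H (q ↑ suc k)         ∎

H-1-q^ : ∀ k → H (1-q^ k) ≈ 1-q^ (k ℕ.* 3)
H-1-q^ k = S.trans (H-⊕ (# 1) (⊝ (q ↑ k)))
  (S.+-cong (H-const (+ 1)) (S.trans (H-⊝ (q ↑ k)) (S.-‿cong (S.sym (q↑[k*3] k)))))

q↑-cube : ∀ k → (q ↑ 3) ↑ k ≈ (q ↑ k) ↑ 3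
q↑-cube zero    = solve 0 (con (+ 1) := con (+ 1) :^ 3) S.refl
q↑-cube (suc k) = S.trans (S.*-congˡ (q↑-cube k))
  (solve 2 (λ q x → q :^ 3 :* x :^ 3 := (q :* x) :^ 3) S.refl q (q ↑ k))

q↑[k*3]-cube : ∀ k → (q ↑ k) ↑ 3 ≈ q ↑ (k ℕ.* 3)
q↑[k*3]-cube k = S.sym (S.trans (q↑[k*3] k)
  (S.trans (H-↑ q k) (S.trans (^-congˡ k H-q) (q↑-cube k))))

Norm-1-q^₁ : ∀ k → Norm (1-q^ suc (k ℕ.* 3)) ≈ 1-q^ suc (k ℕ.* 3)
Norm-1-q^₁ k = begin
  Norm (1-q^ suc (k ℕ.* 3))
    ≈⟨ Norm-cong as-parts ⟩
  Norm (U-parts (# 1) (⊝ (q ↑ k)) (# 0))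
    ≈⟨ Norm-parts _ _ _ ⟩
  norm (# 1) (⊝ (q ↑ k)) (# 0)
    ≈⟨ solve 2 (λ q x → con (+ 1) :^ 3 :+ q :* (:- x) :^ 3 :+ q :^ 2 :* con (+ 0) :^ 3
          :- con (+ 3) :* q :* con (+ 1) :* (:- x) :* con (+ 0)
        := con (+ 1) :- q :* x :^ 3) S.refl q (q ↑ k) ⟩
  # 1 ⊕ ⊝ (q ⊗ (q ↑ k) ↑ 3)
    ≈⟨ S.+-congˡ (S.-‿cong (S.*-congˡ (q↑[k*3]-cube k))) ⟩
  1-q^ suc (k ℕ.* 3) ∎
  where
  as-parts : 1-q^ suc (k ℕ.* 3) ≈ U-parts (# 1) (⊝ (q ↑ k)) (# 0)
  as-parts = S.trans
    (solve 2 (λ q x → con (+ 1) :- q :* x := con (+ 1) :+ q :* (:- x :+ q :* con (+ 0))) S.refl q (q ↑ (k ℕ.* 3)))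
    (S.+-cong (S.sym (H-const (+ 1))) (S.*-congˡ (S.+-cong
      (S.trans (S.-‿cong (q↑[k*3] k)) (S.sym (H-⊝ (q ↑ k)))) (S.*-congˡ (S.sym (H-const (+ 0)))))))

Norm-1-q^₂ : ∀ k → Norm (1-q^ suc (suc (k ℕ.* 3))) ≈ 1-q^ suc (suc (k ℕ.* 3))
Norm-1-q^₂ k = begin
  Norm (1-q^ suc (suc (k ℕ.* 3)))
    ≈⟨ Norm-cong as-parts ⟩
  Norm (U-parts (# 1) (# 0) (⊝ (q ↑ k)))
    ≈⟨ Norm-parts _ _ _ ⟩
  norm (# 1) (# 0) (⊝ (q ↑ k))
    ≈⟨ solve 2 (λ q x → con (+ 1) :^ 3 :+ q :* con (+ 0) :^ 3 :+ q :^ 2 :* (:- x) :^ 3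
          :- con (+ 3) :* q :* con (+ 1) :* con (+ 0) :* (:- x)
        := con (+ 1) :- q :* (q :* x :^ 3)) S.refl q (q ↑ k) ⟩
  # 1 ⊕ ⊝ (q ⊗ (q ⊗ (q ↑ k) ↑ 3))
    ≈⟨ S.+-congˡ (S.-‿cong (S.*-congˡ (S.*-congˡ (q↑[k*3]-cube k)))) ⟩
  1-q^ suc (suc (k ℕ.* 3)) ∎
  where
  as-parts : 1-q^ suc (suc (k ℕ.* 3)) ≈ U-parts (# 1) (# 0) (⊝ (q ↑ k))
  as-parts = S.trans
    (solve 2 (λ q x → con (+ 1) :- q :* (q :* x) := con (+ 1) :+ q :* (con (+ 0) :+ q :* :- x)) S.refl q (q ↑ (k ℕ.* 3)))
    (S.+-cong (S.sym (H-const (+ 1))) (S.*-congˡ (S.+-cong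
      (S.sym (H-const (+ 0))) (S.*-congˡ (S.trans (S.-‿cong (q↑[k*3] k)) (S.sym (H-⊝ (q ↑ k))))))))

Norm-H : ∀ f → Norm (H f) ≈ f ↑ 3
Norm-H f = S.trans (norm-cong (U₀-H f) (U-suc-H 0F f) (U-suc-H 1F f))
  (solve 2 (λ q f → f :^ 3 :+ q :* con (+ 0) :^ 3 :+ q :^ 2 :* con (+ 0) :^ 3
      :- con (+ 3) :* q :* f :* con (+ 0) :* con (+ 0) := f :^ 3) S.refl q f)

-- The norm fixes 1 - qᵐ for m prime to 3 and sends 1 - q³ᵐ to (1 - qᵐ)³. The factor `H (qPoch k)`
-- restores the factors 1 - q³ᵐ that are missing from the full product.
Norm-qPoch : ∀ k → Norm (qPoch (k ℕ.* 3)) ⊗ H (qPoch k) ≈ qPoch (k ℕ.* 3) ⊗ qPoch k ↑ 3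
Norm-qPoch zero = S.*-cong
  (S.trans (Norm-cong (S.sym (H-const (+ 1)))) (S.trans (Norm-H (# 1)) (solve 0 (con (+ 1) :^ 3 := con (+ 1)) S.refl)))
  (S.trans (H-const (+ 1)) (solve 0 (con (+ 1) := con (+ 1) :^ 3) S.refl))
Norm-qPoch (suc k) = begin
  Norm (Q ⊗ u ⊗ v ⊗ w) ⊗ H (qPoch k ⊗ 1-q^ suc k)
    ≈⟨ S.*-cong
         (S.trans (Norm-⊗ (Q ⊗ u ⊗ v) w) (S.*-cong
           (S.trans (Norm-⊗ (Q ⊗ u) v) (S.*-cong (S.trans (Norm-⊗ Q u) (S.*-congˡ (Norm-1-q^₁ k))) (Norm-1-q^₂ k)))
           (S.trans (Norm-cong (S.sym (H-1-q^ (suc k)))) (Norm-H (1-q^ suc k)))))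
         (S.trans (H-⊗ (qPoch k) (1-q^ suc k)) (S.*-congˡ (H-1-q^ (suc k)))) ⟩
  Norm Q ⊗ u ⊗ v ⊗ 1-q^ suc k ↑ 3 ⊗ (H (qPoch k) ⊗ w)
    ≈⟨ solve 6 (λ N u v w y h → N :* u :* v :* y :^ 3 :* (h :* w) := (N :* h) :* u :* v :* w :* y :^ 3) S.refl
         (Norm Q) u v w (1-q^ suc k) (H (qPoch k)) ⟩
  Norm Q ⊗ H (qPoch k) ⊗ u ⊗ v ⊗ w ⊗ 1-q^ suc k ↑ 3
    ≈⟨ S.*-congʳ (S.*-congʳ (S.*-congʳ (S.*-congʳ (Norm-qPoch k)))) ⟩
  Q ⊗ qPoch k ↑ 3 ⊗ u ⊗ v ⊗ w ⊗ 1-q^ suc k ↑ 3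
    ≈⟨ solve 6 (λ Q u v w y x → Q :* x :^ 3 :* u :* v :* w :* y :^ 3 := Q :* u :* v :* w :* (x :* y) :^ 3) S.refl
         Q u v w (1-q^ suc k) (qPoch k) ⟩
  Q ⊗ u ⊗ v ⊗ w ⊗ (qPoch k ⊗ 1-q^ suc k) ↑ 3 ∎
  where
  Q = qPoch (k ℕ.* 3)
  u = 1-q^ suc (k ℕ.* 3)
  v = 1-q^ suc (suc (k ℕ.* 3))
  w = 1-q^ suc (suc (suc (k ℕ.* 3)))

Norm-qPoch∞ : Norm qPoch∞ ⊗ H qPoch∞ ≈ qPoch∞ ↑ 4
Norm-qPoch∞ = ≈[]⇒≈ λ n → ≈[]-trans
  (⊗-cong-≈[]
    -- Coefficient n of the norm needs its argument up to 3n + 2, hence the finite product at 3(n +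
    -- 1).
    (Norm-cong-≈[] n (≈[]-weaken (n*3+2≤ n) (≈[]-sym (qPoch→qPoch∞ (suc n ℕ.* 3)))))
    (H-cong-≈[] (≈[]-weaken (ℕ.m≤n⇒m≤1+n ℕ.≤-refl) (≈[]-sym (qPoch→qPoch∞ (suc n))))))
  (≈[]-trans (≈⇒≈[] (Norm-qPoch (suc n)))
    (⊗-cong-≈[]
      (≈[]-weaken (ℕ.≤-trans (ℕ.m≤m*n n 3) (ℕ.m≤n+m (n ℕ.* 3) 3)) (qPoch→qPoch∞ (suc n ℕ.* 3)))
      (↑-cong-≈[] 3 (≈[]-weaken (ℕ.m≤n⇒m≤1+n ℕ.≤-refl) (qPoch→qPoch∞ (suc n))))))
  where
  n*3+2≤ : ∀ n → n ℕ.* 3 ℕ.+ 2 ℕ.≤ suc n ℕ.* 3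
  n*3+2≤ n = ℕ.≤-trans (ℕ.≤-reflexive (ℕ.+-comm (n ℕ.* 3) 2)) (ℕ.n≤1+n _)

-- The 3-dissection of Jacobi's series

-- The exponent j(j+1)/2 is 1 modulo 3 for j = 3i + 1, where it equals 9 · i(i+1)/2 + 1, and 0
-- modulo 3 otherwise. The three statements are one induction along j, each following from its
-- predecessor by a single unfolding of `θ`.
θ₁ : ∀ i → θ (suc (i ℕ.* 3)) ≈ ⊝ (q ⊗ H (H (θ i)))
θ₂ : ∀ i → θ (suc (suc (i ℕ.* 3))) ≈ H (q ⊗ q ↑ i ⊗ H (θ i))
θ₀ : ∀ i → θ (suc i ℕ.* 3) ≈ H (⊝ (q ⊗ q ↑ i ⊗ (q ⊗ q ↑ i ⊗ H (θ i))))

θ₁ zero = S.-‿cong (S.trans (S.*-identityʳ _) (S.*-congˡ (S.sym (S.trans (H-cong (H-const (+ 1))) (H-const (+ 1))))))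
θ₁ (suc i) = begin
  ⊝ (q ⊗ q ↑ (suc i ℕ.* 3) ⊗ θ (suc i ℕ.* 3))
    ≈⟨ S.-‿cong (S.*-cong (S.*-congˡ (q↑[k*3] (suc i))) (θ₀ i)) ⟩
  ⊝ (q ⊗ H (q ⊗ q ↑ i) ⊗ H (⊝ (q ⊗ q ↑ i ⊗ (q ⊗ q ↑ i ⊗ H (θ i)))))
    ≈⟨ S.-‿cong (S.trans (S.*-assoc q _ _) (S.*-congˡ (S.trans (S.sym (H-⊗ _ _)) (H-cong (begin
        q ⊗ q ↑ i ⊗ ⊝ (q ⊗ q ↑ i ⊗ (q ⊗ q ↑ i ⊗ H (θ i)))
          ≈⟨ solve 3 (λ q x h → q :* x :* :- (q :* x :* (q :* x :* h)) := :- ((q :* x) :^ 3 :* h)) S.refl q (q ↑ i) (H (θ i)) ⟩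
        ⊝ ((q ↑ suc i) ↑ 3 ⊗ H (θ i))
          ≈⟨ S.-‿cong (S.*-congʳ (S.trans (q↑[k*3]-cube (suc i)) (q↑[k*3] (suc i)))) ⟩
        ⊝ (H (q ↑ suc i) ⊗ H (θ i))
          ≈⟨ S.trans (H-⊝ _) (S.-‿cong (H-⊗ _ _)) ⟨
        H (⊝ (q ↑ suc i ⊗ θ i)) ∎))))) ⟩
  ⊝ (q ⊗ H (H (θ (suc i)))) ∎
θ₂ i = begin
  ⊝ (q ⊗ (q ⊗ q ↑ (i ℕ.* 3)) ⊗ θ (suc (i ℕ.* 3)))
    ≈⟨ S.-‿cong (S.*-cong (S.*-congˡ (S.*-congˡ (q↑[k*3] i))) (θ₁ i)) ⟩
  ⊝ (q ⊗ (q ⊗ H (q ↑ i)) ⊗ ⊝ (q ⊗ H (H (θ i))))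
    ≈⟨ solve 3 (λ q y h → :- (q :* (q :* y) :* :- (q :* h)) := q :^ 3 :* y :* h) S.refl q (H (q ↑ i)) (H (H (θ i))) ⟩
  q ↑ 3 ⊗ H (q ↑ i) ⊗ H (H (θ i))
    ≈⟨ S.trans (H-⊗ _ _) (S.*-congʳ (S.trans (H-⊗ q (q ↑ i)) (S.*-congʳ H-q))) ⟨
  H (q ⊗ q ↑ i ⊗ H (θ i)) ∎
θ₀ i = begin
  ⊝ (q ↑ (suc i ℕ.* 3) ⊗ θ (suc (suc (i ℕ.* 3))))
    ≈⟨ S.-‿cong (S.*-cong (q↑[k*3] (suc i)) (θ₂ i)) ⟩
  ⊝ (H (q ⊗ q ↑ i) ⊗ H (q ⊗ q ↑ i ⊗ H (θ i)))
    ≈⟨ S.trans (H-⊝ _) (S.-‿cong (H-⊗ _ _)) ⟨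
  H (⊝ (q ⊗ q ↑ i ⊗ (q ⊗ q ↑ i ⊗ H (θ i)))) ∎

H-odd : ∀ j → H (odd j) ≈ odd j
H-odd zero    = H-const (+ 1)
H-odd (suc j) = S.trans (H-⊕ (odd j) (# 2)) (S.+-cong (H-odd j) (H-const (+ 2)))

-- This is the origin of the 3 in the term 3q e(q⁹).
odd-[3i+1] : ∀ i → odd (suc (i ℕ.* 3)) ≈ # 3 ⊗ odd i
odd-[3i+1] zero    = solve 0 (con (+ 1) :+ con (+ 2) := con (+ 3) :* con (+ 1)) S.refl
odd-[3i+1] (suc i) = S.trans (S.+-congʳ (S.+-congʳ (S.+-congʳ (odd-[3i+1] i))))
  (solve 1 (λ c → con (+ 3) :* c :+ con (+ 2) :+ con (+ 2) :+ con (+ 2) := con (+ 3) :* (c :+ con (+ 2))) S.refl (odd i))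

U-odd⊗ : ∀ r j f → U r (odd j ⊗ f) ≈ odd j ⊗ U r f
U-odd⊗ r j f = S.trans (U-cong r (S.*-congʳ (S.sym (H-odd j)))) (U-H⊗ r (odd j) f)

U-suc-odd⊗H : ∀ r j {f g} → f ≈ H g → U (suc r) (odd j ⊗ f) ≈ # 0
U-suc-odd⊗H r j {f} {g} p = S.trans (U-odd⊗ (suc r) j f)
  (S.trans (S.*-congˡ (S.trans (U-cong (suc r) p) (U-suc-H r g))) (S.zeroʳ (odd j)))

U₁-θ₁-term : ∀ i → U 1F (odd (suc (i ℕ.* 3)) ⊗ θ (suc (i ℕ.* 3))) ≈ ⊝ (# 3 ⊗ H (odd i ⊗ θ i))
U₁-θ₁-term i = begin
  U 1F (odd (suc (i ℕ.* 3)) ⊗ θ (suc (i ℕ.* 3)))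
    ≈⟨ S.trans (U-odd⊗ 1F (suc (i ℕ.* 3)) _) (S.*-cong (odd-[3i+1] i)
         (S.trans (U-cong 1F (θ₁ i)) (S.trans (U-⊝ 1F _) (S.-‿cong (S.trans (U₁-q⊗ _) (U₀-H _)))))) ⟩
  # 3 ⊗ odd i ⊗ ⊝ H (θ i)
    ≈⟨ solve 2 (λ c h → con (+ 3) :* c :* :- h := :- (con (+ 3) :* (c :* h))) S.refl (odd i) (H (θ i)) ⟩
  ⊝ (# 3 ⊗ (odd i ⊗ H (θ i)))
    ≈⟨ S.-‿cong (S.*-congˡ (S.trans (H-⊗ _ _) (S.*-congʳ (H-odd i)))) ⟨
  ⊝ (# 3 ⊗ H (odd i ⊗ θ i)) ∎

U₂-θ₁-term : ∀ i → U 2F (odd (suc (i ℕ.* 3)) ⊗ θ (suc (i ℕ.* 3))) ≈ # 0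
U₂-θ₁-term i = S.trans (U-odd⊗ 2F (suc (i ℕ.* 3)) _)
  (S.trans (S.*-congˡ (S.trans (U-cong 2F (θ₁ i)) (S.trans (U-⊝ 2F _)
    (S.trans (S.-‿cong (S.trans (U₂-q⊗ _) (U-suc-H 0F _))) (solve 0 (:- con (+ 0) := con (+ 0)) S.refl)))))
    (S.zeroʳ _))

-- Cutting at 3k + 2 keeps whole blocks of three terms, so a truncated sum is carried to a truncated
-- sum exactly.
U₁-oddSum-θ : ∀ k → U 1F (oddSum θ (suc (suc (k ℕ.* 3)))) ≈ ⊝ (# 3 ⊗ H (oddSum θ k))
U₁-oddSum-θ zero = begin
  U 1F (odd 0 ⊗ θ 0 ⊕ odd 1 ⊗ θ 1 ⊕ odd 2 ⊗ θ 2)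
    ≈⟨ S.trans (U-⊕ 1F _ _) (S.+-cong
         (S.trans (U-⊕ 1F _ _) (S.+-cong (U-suc-odd⊗H 0F 0 (S.sym (H-const (+ 1)))) (U₁-θ₁-term 0))) (U-suc-odd⊗H 0F 2 (θ₂ 0))) ⟩
  # 0 ⊕ ⊝ (# 3 ⊗ H (odd 0 ⊗ θ 0)) ⊕ # 0
    ≈⟨ solve 1 (λ x → con (+ 0) :- x :+ con (+ 0) := :- x) S.refl (# 3 ⊗ H (odd 0 ⊗ θ 0)) ⟩
  ⊝ (# 3 ⊗ H (odd 0 ⊗ θ 0)) ∎
U₁-oddSum-θ (suc k) = begin
  U 1F (oddSum θ (suc (suc (k ℕ.* 3))) ⊕ T₀ ⊕ T₁ ⊕ T₂)
    ≈⟨ S.trans (U-⊕ 1F _ T₂) (S.+-cong (S.trans (U-⊕ 1F _ T₁) (S.+-cong (S.trans (U-⊕ 1F _ T₀)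
         (S.+-cong (U₁-oddSum-θ k) (U-suc-odd⊗H 0F (suc k ℕ.* 3) (θ₀ k)))) (U₁-θ₁-term (suc k)))) (U-suc-odd⊗H 0F (suc (suc (suc k ℕ.* 3))) (θ₂ (suc k)))) ⟩
  ⊝ (# 3 ⊗ H (oddSum θ k)) ⊕ # 0 ⊕ ⊝ (# 3 ⊗ H t) ⊕ # 0
    ≈⟨ solve 2 (λ x y → :- (con (+ 3) :* x) :+ con (+ 0) :- con (+ 3) :* y :+ con (+ 0) := :- (con (+ 3) :* (x :+ y)))
         S.refl (H (oddSum θ k)) (H t) ⟩
  ⊝ (# 3 ⊗ (H (oddSum θ k) ⊕ H t))
    ≈⟨ S.-‿cong (S.*-congˡ (H-⊕ (oddSum θ k) t)) ⟨
  ⊝ (# 3 ⊗ H (oddSum θ k ⊕ t)) ∎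
  where
  t  = odd (suc k) ⊗ θ (suc k)
  T₀ = odd (suc k ℕ.* 3) ⊗ θ (suc k ℕ.* 3)
  T₁ = odd (suc (suc k ℕ.* 3)) ⊗ θ (suc (suc k ℕ.* 3))
  T₂ = odd (suc (suc (suc k ℕ.* 3))) ⊗ θ (suc (suc (suc k ℕ.* 3)))

U₂-oddSum-θ : ∀ k → U 2F (oddSum θ (suc (suc (k ℕ.* 3)))) ≈ # 0
U₂-oddSum-θ zero = S.trans (U-⊕ 2F _ _) (S.trans (S.+-cong
  (S.trans (U-⊕ 2F _ _) (S.+-cong (U-suc-odd⊗H 1F 0 (S.sym (H-const (+ 1)))) (U₂-θ₁-term 0))) (U-suc-odd⊗H 1F 2 (θ₂ 0)))
  (solve 0 (con (+ 0) :+ con (+ 0) :+ con (+ 0) := con (+ 0)) S.refl))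
U₂-oddSum-θ (suc k) = S.trans (U-⊕ 2F _ _) (S.trans
  (S.+-cong (S.trans (U-⊕ 2F _ _) (S.+-cong (S.trans (U-⊕ 2F _ _)
     (S.+-cong (U₂-oddSum-θ k) (U-suc-odd⊗H 1F (suc k ℕ.* 3) (θ₀ k)))) (U₂-θ₁-term (suc k))))
     (U-suc-odd⊗H 1F (suc (suc (suc k ℕ.* 3))) (θ₂ (suc k))))
  (solve 0 (con (+ 0) :+ con (+ 0) :+ con (+ 0) :+ con (+ 0) := con (+ 0)) S.refl))

jacobi-identity-3n+2 : ∀ n → qPoch∞ ↑ 3 ≈[ n ℕ.* 3 ℕ.+ 2 ] oddSum θ (suc (suc (n ℕ.* 3)))
jacobi-identity-3n+2 n = ≈[]-weaken (ℕ.≤-reflexive (ℕ.+-comm (n ℕ.* 3) 2)) (jacobi-identity (suc (suc (n ℕ.* 3))))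

U₁-qPoch∞³ : U 1F (qPoch∞ ↑ 3) ≈ ⊝ (# 3 ⊗ H (qPoch∞ ↑ 3))
U₁-qPoch∞³ = ≈[]⇒≈ λ n → ≈[]-trans
  (U-cong-≈[] 1F n (jacobi-identity-3n+2 n))
  (≈[]-trans (≈⇒≈[] (U₁-oddSum-θ n))
    (⊝-cong-≈[] (⊗-cong-≈[] (≈[]-refl {# 3}) (H-cong-≈[] (≈[]-sym (jacobi-identity n))))))

U₂-qPoch∞³ : U 2F (qPoch∞ ↑ 3) ≈ # 0
U₂-qPoch∞³ = ≈[]⇒≈ λ n → ≈[]-trans
  (U-cong-≈[] 2F n (jacobi-identity-3n+2 n))
  (≈⇒≈[] (U₂-oddSum-θ n))

-- Relations between w and t

-- `p` is 1/e, so `p ↑ 2` generates p₁,₃; `B` is e(q³) and `b` is e(q⁹).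
e p A B b : ℤ⟦q⟧
e = qPoch∞ ↑ 3
p = qPoch∞⁻¹ ↑ 3
A = U 0F e
B = H e
b = H B

ep≈1 : e ⊗ p ≈ # 1
ep≈1 = S.trans (solve 2 (λ x y → x :^ 3 :* y :^ 3 := (x :* y) :^ 3) S.refl qPoch∞ qPoch∞⁻¹)
  (S.trans (^-congˡ 3 qPoch∞-inverse) (solve 0 (con (+ 1) :^ 3 := con (+ 1)) S.refl))

BHp≈1 : B ⊗ H p ≈ # 1
BHp≈1 = S.trans (S.sym (H-⊗ e p)) (S.trans (H-cong ep≈1) (H-const (+ 1)))

e-parts : e ≈ H A ⊕ ⊝ (# 3 ⊗ q ⊗ b)
e-parts = begin
  e
    ≈⟨ S.trans (U-parts-complete e) (U-parts-cong S.refl U₁-qPoch∞³ U₂-qPoch∞³) ⟩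
  H A ⊕ q ⊗ (H (⊝ (# 3 ⊗ B)) ⊕ q ⊗ H (# 0))
    ≈⟨ S.+-congˡ (S.*-congˡ (S.+-cong
         (S.trans (H-⊝ _) (S.-‿cong (S.trans (H-⊗ _ _) (S.*-congʳ (H-const (+ 3))))))
         (S.*-congˡ (H-const (+ 0))))) ⟩
  H A ⊕ q ⊗ (⊝ (# 3 ⊗ b) ⊕ q ⊗ # 0)
    ≈⟨ solve 3 (λ a q b → a :+ q :* (:- (con (+ 3) :* b) :+ q :* con (+ 0)) := a :- con (+ 3) :* q :* b) S.refl (H A) q b ⟩
  H A ⊕ ⊝ (# 3 ⊗ q ⊗ b) ∎

-- `N` is the norm of e, and `M`, which is e(q³)/e⁴, is its inverse.
N M : ℤ⟦q⟧
N = A ↑ 3 ⊕ ⊝ (# 27 ⊗ q ⊗ B ↑ 3)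
M = p ↑ 4 ⊗ B

Norm-e : Norm e ≈ N
Norm-e = S.trans (norm-cong S.refl U₁-qPoch∞³ U₂-qPoch∞³)
  (solve 3 (λ a q b → a :^ 3 :+ q :* (:- (con (+ 3) :* b)) :^ 3 :+ q :^ 2 :* con (+ 0) :^ 3
      :- con (+ 3) :* q :* a :* :- (con (+ 3) :* b) :* con (+ 0) := a :^ 3 :- con (+ 27) :* q :* b :^ 3) S.refl A q B)

NB≈e⁴ : N ⊗ B ≈ e ↑ 4
NB≈e⁴ = begin
  N ⊗ B
    ≈⟨ S.*-cong (S.sym Norm-e) (H-↑ qPoch∞ 3) ⟩
  Norm e ⊗ H qPoch∞ ↑ 3
    ≈⟨ S.*-congʳ (S.trans (Norm-⊗ _ _) (S.*-congˡ (S.trans (Norm-⊗ _ _) (S.*-congˡ (S.trans (Norm-⊗ _ _)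
         (S.*-congˡ (S.trans (Norm-cong (S.sym (H-const (+ 1)))) (Norm-H (# 1))))))))) ⟩
  Norm qPoch∞ ⊗ (Norm qPoch∞ ⊗ (Norm qPoch∞ ⊗ # 1 ↑ 3)) ⊗ H qPoch∞ ↑ 3
    ≈⟨ solve 2 (λ n h → n :* (n :* (n :* con (+ 1) :^ 3)) :* h :^ 3 := (n :* h) :^ 3) S.refl (Norm qPoch∞) (H qPoch∞) ⟩
  (Norm qPoch∞ ⊗ H qPoch∞) ↑ 3
    ≈⟨ ^-congˡ 3 Norm-qPoch∞ ⟩
  (qPoch∞ ↑ 4) ↑ 3
    ≈⟨ solve 1 (λ x → (x :^ 4) :^ 3 := (x :^ 3) :^ 4) S.refl qPoch∞ ⟩
  e ↑ 4 ∎

NM≈1 : N ⊗ M ≈ # 1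
NM≈1 = begin
  N ⊗ (p ↑ 4 ⊗ B)   ≈⟨ solve 3 (λ n p b → n :* (p :^ 4 :* b) := n :* b :* p :^ 4) S.refl N p B ⟩
  N ⊗ B ⊗ p ↑ 4     ≈⟨ S.*-congʳ NB≈e⁴ ⟩
  e ↑ 4 ⊗ p ↑ 4     ≈⟨ solve 2 (λ e p → e :^ 4 :* p :^ 4 := (e :* p) :^ 4) S.refl e p ⟩
  (e ⊗ p) ↑ 4       ≈⟨ ^-congˡ 4 ep≈1 ⟩
  # 1 ↑ 4           ≈⟨ solve 0 (con (+ 1) :^ 4 := con (+ 1)) S.refl ⟩
  # 1               ∎

H-N : H N ≈ H A ↑ 3 ⊕ ⊝ (# 27 ⊗ q ↑ 3 ⊗ b ↑ 3)
H-N = S.trans (H-⊕ _ _) (S.+-cong (H-↑ A 3) (S.trans (H-⊝ _) (S.-‿cong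
  (S.trans (H-⊗ _ _) (S.*-cong (S.trans (H-⊗ _ _) (S.*-cong (H-const (+ 27)) H-q)) (H-↑ B 3))))))

HN⊗HM≈1 : H N ⊗ H M ≈ # 1
HN⊗HM≈1 = S.trans (S.sym (H-⊗ N M)) (S.trans (H-cong NM≈1) (H-const (+ 1)))

w t T : ℤ⟦q⟧
w = q ⊗ b ⊗ p
t = q ⊗ B ↑ 3 ⊗ M
T = H t

T-expand : T ≈ q ↑ 3 ⊗ b ↑ 3 ⊗ H M
T-expand = S.trans (H-⊗ _ _) (S.*-congʳ (S.trans (H-⊗ _ _) (S.*-cong H-q (H-↑ B 3))))

HA-expand : H A ≈ e ⊕ # 3 ⊗ q ⊗ b
HA-expand = S.trans (solve 2 (λ a x → a := a :- x :+ x) S.refl (H A) (# 3 ⊗ q ⊗ b)) (S.+-congʳ (S.sym e-parts))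

-- From (x + 3y)³ - 27y³ = x³ + 9x²y + 27xy² at x = e, y = q b, divided by e³.
p³-HN : p ↑ 3 ⊗ H N ≈ # 1 ⊕ # 9 ⊗ w ⊕ # 27 ⊗ w ↑ 2
p³-HN = begin
  p ↑ 3 ⊗ H N
    ≈⟨ S.*-congˡ (S.trans H-N (S.+-congʳ (^-congˡ 3 HA-expand))) ⟩
  p ↑ 3 ⊗ ((e ⊕ # 3 ⊗ q ⊗ b) ↑ 3 ⊕ ⊝ (# 27 ⊗ q ↑ 3 ⊗ b ↑ 3))
    ≈⟨ solve 4 (λ p e q b → p :^ 3 :* ((e :+ con (+ 3) :* q :* b) :^ 3 :- con (+ 27) :* q :^ 3 :* b :^ 3)
         := (e :* p) :^ 3 :+ con (+ 9) :* (e :* p) :^ 2 :* (q :* b :* p) :+ con (+ 27) :* (e :* p) :* (q :* b :* p) :^ 2)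
       S.refl p e q b ⟩
  (e ⊗ p) ↑ 3 ⊕ # 9 ⊗ (e ⊗ p) ↑ 2 ⊗ w ⊕ # 27 ⊗ (e ⊗ p) ⊗ w ↑ 2
    ≈⟨ S.+-cong (S.+-cong (^-congˡ 3 ep≈1) (S.*-congʳ (S.*-congˡ (^-congˡ 2 ep≈1)))) (S.*-congʳ (S.*-congˡ ep≈1)) ⟩
  # 1 ↑ 3 ⊕ # 9 ⊗ # 1 ↑ 2 ⊗ w ⊕ # 27 ⊗ # 1 ⊗ w ↑ 2
    ≈⟨ solve 1 (λ w → con (+ 1) :^ 3 :+ con (+ 9) :* con (+ 1) :^ 2 :* w :+ con (+ 27) :* con (+ 1) :* w :^ 2
         := con (+ 1) :+ con (+ 9) :* w :+ con (+ 27) :* w :^ 2) S.refl w ⟩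
  # 1 ⊕ # 9 ⊗ w ⊕ # 27 ⊗ w ↑ 2 ∎

w-cubic : w ↑ 3 ≈ T ⊗ (# 1 ⊕ # 9 ⊗ w ⊕ # 27 ⊗ w ↑ 2)
w-cubic = begin
  (q ⊗ b ⊗ p) ↑ 3
    ≈⟨ solve 3 (λ q b p → (q :* b :* p) :^ 3 := q :^ 3 :* b :^ 3 :* con (+ 1) :* p :^ 3) S.refl q b p ⟩
  q ↑ 3 ⊗ b ↑ 3 ⊗ # 1 ⊗ p ↑ 3
    ≈⟨ S.*-congʳ (S.*-congˡ (S.sym HN⊗HM≈1)) ⟩
  q ↑ 3 ⊗ b ↑ 3 ⊗ (H N ⊗ H M) ⊗ p ↑ 3
    ≈⟨ solve 4 (λ x n m p → x :* (n :* m) :* p := x :* m :* (p :* n)) S.refl (q ↑ 3 ⊗ b ↑ 3) (H N) (H M) (p ↑ 3) ⟩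
  q ↑ 3 ⊗ b ↑ 3 ⊗ H M ⊗ (p ↑ 3 ⊗ H N)
    ≈⟨ S.*-cong (S.sym T-expand) p³-HN ⟩
  T ⊗ (# 1 ⊕ # 9 ⊗ w ⊕ # 27 ⊗ w ↑ 2) ∎

-- By `NB≈e⁴` at q³, B⁴ = N(q³) b, so t is w times p³ N(q³), the same cofactor as in `w-cubic`.
t-poly : t ≈ w ⊗ (# 1 ⊕ # 9 ⊗ w ⊕ # 27 ⊗ w ↑ 2)
t-poly = begin
  q ⊗ B ↑ 3 ⊗ (p ↑ 4 ⊗ B)
    ≈⟨ solve 3 (λ q b p → q :* b :^ 3 :* (p :^ 4 :* b) := q :* p :^ 4 :* b :^ 4) S.refl q B p ⟩
  q ⊗ p ↑ 4 ⊗ B ↑ 4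
    ≈⟨ S.*-congˡ (S.trans (S.sym (H-↑ e 4)) (S.trans (H-cong (S.sym NB≈e⁴)) (H-⊗ N B))) ⟩
  q ⊗ p ↑ 4 ⊗ (H N ⊗ b)
    ≈⟨ solve 4 (λ q p n b → q :* p :^ 4 :* (n :* b) := q :* b :* p :* (p :^ 3 :* n)) S.refl q p (H N) b ⟩
  w ⊗ (p ↑ 3 ⊗ H N)
    ≈⟨ S.*-congˡ p³-HN ⟩
  w ⊗ (# 1 ⊕ # 9 ⊗ w ⊕ # 27 ⊗ w ↑ 2) ∎

X Y : ℤ⟦q⟧
X = A ↑ 2 ⊗ B ⊗ M
Y = A ⊗ B ↑ 2 ⊗ M

-- Rationalising the denominator with a = A(q³): 1/(a - 3q b) = (a² + 3q a b + 9q² b²)/(a³ - 27q³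
-- b³), whose denominator is N(q³).
w-parts : w ≈ U-parts (# 9 ⊗ t) X (# 3 ⊗ Y)
w-parts = begin
  q ⊗ b ⊗ p
    ≈⟨ solve 3 (λ q b p → q :* b :* p := q :* b :* p :* con (+ 1)) S.refl q b p ⟩
  q ⊗ b ⊗ p ⊗ # 1
    ≈⟨ S.*-congˡ (S.sym HN⊗HM≈1) ⟩
  q ⊗ b ⊗ p ⊗ (H N ⊗ H M)
    ≈⟨ S.*-congˡ (S.*-congʳ H-N) ⟩
  q ⊗ b ⊗ p ⊗ ((H A ↑ 3 ⊕ ⊝ (# 27 ⊗ q ↑ 3 ⊗ b ↑ 3)) ⊗ H M)
    ≈⟨ solve 5 (λ q b p a m → q :* b :* p :* ((a :^ 3 :- con (+ 27) :* q :^ 3 :* b :^ 3) :* m)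
         := (a :- con (+ 3) :* q :* b) :* p :* (q :* b :* m :* (a :^ 2 :+ con (+ 3) :* q :* a :* b :+ con (+ 9) :* q :^ 2 :* b :^ 2)))
       S.refl q b p (H A) (H M) ⟩
  (H A ⊕ ⊝ (# 3 ⊗ q ⊗ b)) ⊗ p ⊗ (q ⊗ b ⊗ H M ⊗ (H A ↑ 2 ⊕ # 3 ⊗ q ⊗ H A ⊗ b ⊕ # 9 ⊗ q ↑ 2 ⊗ b ↑ 2))
    ≈⟨ S.*-congʳ (S.trans (S.*-congʳ (S.sym e-parts)) ep≈1) ⟩
  # 1 ⊗ (q ⊗ b ⊗ H M ⊗ (H A ↑ 2 ⊕ # 3 ⊗ q ⊗ H A ⊗ b ⊕ # 9 ⊗ q ↑ 2 ⊗ b ↑ 2))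
    ≈⟨ solve 4 (λ q b m a → con (+ 1) :* (q :* b :* m :* (a :^ 2 :+ con (+ 3) :* q :* a :* b :+ con (+ 9) :* q :^ 2 :* b :^ 2))
         := con (+ 9) :* (q :^ 3 :* b :^ 3 :* m) :+ q :* (a :^ 2 :* b :* m :+ q :* (con (+ 3) :* (a :* b :^ 2 :* m))))
       S.refl q b (H M) (H A) ⟩
  # 9 ⊗ (q ↑ 3 ⊗ b ↑ 3 ⊗ H M) ⊕ q ⊗ (H A ↑ 2 ⊗ b ⊗ H M ⊕ q ⊗ (# 3 ⊗ (H A ⊗ b ↑ 2 ⊗ H M)))
    ≈⟨ S.+-cong
         (S.trans (S.*-cong (S.sym (H-const (+ 9))) (S.sym T-expand)) (S.sym (H-⊗ _ _)))
         (S.*-congˡ (S.+-cong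
           (S.trans (S.*-congʳ (S.trans (S.*-congʳ (S.sym (H-↑ A 2))) (S.sym (H-⊗ _ _)))) (S.sym (H-⊗ _ _)))
           (S.*-congˡ (S.trans (S.*-cong (S.sym (H-const (+ 3)))
             (S.trans (S.*-congʳ (S.trans (S.*-congˡ (S.sym (H-↑ B 2))) (S.sym (H-⊗ _ _)))) (S.sym (H-⊗ _ _))))
             (S.sym (H-⊗ _ _)))))) ⟩
  U-parts (# 9 ⊗ t) X (# 3 ⊗ Y) ∎

U₀-w : U 0F w ≈ # 9 ⊗ t
U₀-w = S.trans (U-cong 0F w-parts) (U₀-parts _ _ _)

U₂-w : U 2F w ≈ # 3 ⊗ Y
U₂-w = S.trans (U-cong 2F w-parts) (U₂-parts _ _ _)

U₀-w² : U 0F (w ↑ 2) ≈ # 6 ⊗ t ⊕ # 243 ⊗ t ↑ 2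
U₀-w² = begin
  U 0F (w ↑ 2)
    ≈⟨ U-cong 0F (S.trans (S.*-congˡ (S.*-identityʳ w)) (S.trans (S.*-cong w-parts w-parts) (U-parts-⊗ _ _ _ _ _ _))) ⟩
  _
    ≈⟨ U₀-parts _ _ _ ⟩
  # 9 ⊗ t ⊗ (# 9 ⊗ t) ⊕ q ⊗ (X ⊗ (# 3 ⊗ Y) ⊕ # 3 ⊗ Y ⊗ X)
    -- Here q X Y = t A³ M, and A³ = N + 27q B³ gives A³ M = N M + 27t. The total is 81t² + 6t(N M +
    -- 27t).
    ≈⟨ solve 4 (λ q a b m →
         let t = q :* b :^ 3 :* m ; x = a :^ 2 :* b :* m ; y = a :* b :^ 2 :* m in
         con (+ 9) :* t :* (con (+ 9) :* t) :+ q :* (x :* (con (+ 3) :* y) :+ con (+ 3) :* y :* x)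
         := con (+ 243) :* t :^ 2 :+ con (+ 6) :* t :* ((a :^ 3 :- con (+ 27) :* q :* b :^ 3) :* m))
       S.refl q A B M ⟩
  # 243 ⊗ t ↑ 2 ⊕ # 6 ⊗ t ⊗ (N ⊗ M)
    ≈⟨ S.+-congˡ (S.*-congˡ NM≈1) ⟩
  # 243 ⊗ t ↑ 2 ⊕ # 6 ⊗ t ⊗ # 1
    ≈⟨ solve 1 (λ t → con (+ 243) :* t :^ 2 :+ con (+ 6) :* t :* con (+ 1) := con (+ 6) :* t :+ con (+ 243) :* t :^ 2) S.refl t ⟩
  # 6 ⊗ t ⊕ # 243 ⊗ t ↑ 2 ∎

-- The action of U₀ on polynomials in v and τ

infixl 5 _⊞_

-- Span b x is b ℕ[x]: all coefficients that occur are nonnegative.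
data Span (b x : ℤ⟦q⟧) : ℤ⟦q⟧ → Set where
  base  : Span b x b
  _⊞_   : ∀ {f g} → Span b x f → Span b x g → Span b x (f ⊕ g)
  scale : ∀ n {f} → Span b x f → Span b x (# n ⊗ f)
  mul   : ∀ {f} → Span b x f → Span b x (x ⊗ f)
  resp  : ∀ {f g} → f ≈ g → Span b x f → Span b x g

Span-⊗ : ∀ {b x f} c → Span b x f → Span (c ⊗ b) x (c ⊗ f)
Span-⊗ c base = base
Span-⊗ c (_⊞_ {f} {g} s s′) = resp (S.sym (S.distribˡ c f g)) (Span-⊗ c s ⊞ Span-⊗ c s′)
Span-⊗ c (scale n {f} s) = resp (solve 3 (λ n c f → n :* (c :* f) := c :* (n :* f)) S.refl (# n) c f) (scale n (Span-⊗ c s))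
Span-⊗ {x = x} c (mul {f} s) = resp (solve 3 (λ x c f → x :* (c :* f) := c :* (x :* f)) S.refl x c f) (mul (Span-⊗ c s))
Span-⊗ c (resp eq s) = resp (S.*-congˡ eq) (Span-⊗ c s)

-- The cofactor is returned together with its polynomial form, so that a 9 or a `T` can be pulled
-- out and the induction continued.
Span-⊗⁻¹ : ∀ {b x f} c → Span (c ⊗ b) x f → ∃ λ g → Span b x g × f ≈ c ⊗ g
Span-⊗⁻¹ {b} c base = b , base , S.refl
Span-⊗⁻¹ c (s ⊞ s′) with Span-⊗⁻¹ c s | Span-⊗⁻¹ c s′
... | g , r , eq | g′ , r′ , eq′ = g ⊕ g′ , r ⊞ r′ , S.trans (S.+-cong eq eq′) (S.sym (S.distribˡ c g g′))
Span-⊗⁻¹ c (scale n s) with Span-⊗⁻¹ c s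
... | g , r , eq = # n ⊗ g , scale n r ,
  S.trans (S.*-congˡ eq) (solve 3 (λ n c f → n :* (c :* f) := c :* (n :* f)) S.refl (# n) c g)
Span-⊗⁻¹ {x = x} c (mul s) with Span-⊗⁻¹ c s
... | g , r , eq = x ⊗ g , mul r ,
  S.trans (S.*-congˡ eq) (solve 3 (λ n c f → n :* (c :* f) := c :* (n :* f)) S.refl x c g)
Span-⊗⁻¹ c (resp eq s) with Span-⊗⁻¹ c s
... | g , r , eq′ = g , r , S.trans (S.sym eq) eq′

Span-trans : ∀ {b x c y f} → Span c y b → (∀ {g} → Span c y g → Span c y (x ⊗ g)) →
             Span b x f → Span c y f
Span-trans r m base        = r
Span-trans r m (s ⊞ s′)    = Span-trans r m s ⊞ Span-trans r m s′
Span-trans r m (scale n s) = scale n (Span-trans r m s)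
Span-trans r m (mul s)     = m (Span-trans r m s)
Span-trans r m (resp eq s) = resp eq (Span-trans r m s)

v τ : ℤ⟦q⟧
v = # 3 ⊗ w
τ = # 27 ⊗ t

t∈wℕ[v] : Span w v t
t∈wℕ[v] = resp
  (S.sym (S.trans t-poly (solve 1 (λ w → w :* (con (+ 1) :+ con (+ 9) :* w :+ con (+ 27) :* w :^ 2)
     := w :+ con (+ 3) :* ((con (+ 3) :* w) :* w) :+ con (+ 3) :* ((con (+ 3) :* w) :* ((con (+ 3) :* w) :* w))) S.refl w)))
  (base ⊞ scale 3 (mul base) ⊞ scale 3 (mul (mul base)))

τ⊗-Span-v : ∀ {b f} → Span b v f → Span b v (τ ⊗ f)
τ⊗-Span-v {f = f} s = resp
  (S.sym (S.trans (S.*-congʳ (S.*-congˡ t-poly)) (solve 2 (λ w f →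
     con (+ 27) :* (w :* (con (+ 1) :+ con (+ 9) :* w :+ con (+ 27) :* w :^ 2)) :* f
     := let v = con (+ 3) :* w in con (+ 9) :* (v :* f) :+ con (+ 27) :* (v :* (v :* f)) :+ con (+ 27) :* (v :* (v :* (v :* f))))
     S.refl w f)))
  (scale 9 (mul s) ⊞ scale 27 (mul (mul s)) ⊞ scale 27 (mul (mul (mul s))))

tℕ[τ]⊆wℕ[v] : ∀ {f} → Span t τ f → Span w v f
tℕ[τ]⊆wℕ[v] = Span-trans t∈wℕ[v] τ⊗-Span-v

U-# : ∀ r n f → U r (# n ⊗ f) ≈ # n ⊗ U r f
U-# r n f = S.trans (U-cong r (S.*-congʳ (S.sym (H-const (+ n))))) (U-H⊗ r (# n) f)

-- The cubic for v makes U₀ (vⁿ f) a linear recurrence of order three in n, so three consecutive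
-- values are carried along.
record U₀-Span (c f : ℤ⟦q⟧) : Set where
  constructor ⟨_,_,_⟩
  field
    s₀ : Span c τ (U 0F f)
    s₁ : Span c τ (U 0F (v ⊗ f))
    s₂ : Span c τ (U 0F (v ⊗ (v ⊗ f)))

-- Multiplication by v preserves U₀-Span because v³ = τ(q³)(1 + 3v + 3v²).
U₀-Span-closed : ∀ {c b f} → U₀-Span c b → Span b v f → U₀-Span c f
U₀-Span-closed r base = r
U₀-Span-closed r (_⊞_ {f} {g} s s′) with U₀-Span-closed r s | U₀-Span-closed r s′
... | ⟨ s₀ , s₁ , s₂ ⟩ | ⟨ s₀′ , s₁′ , s₂′ ⟩ = ⟨ add S.refl s₀ s₀′ , add (S.distribˡ v f g) s₁ s₁′
  , add (S.trans (S.*-congˡ (S.distribˡ v f g)) (S.distribˡ v (v ⊗ f) (v ⊗ g))) s₂ s₂′ ⟩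
  where
  add : ∀ {c x y z} → z ≈ x ⊕ y → Span c τ (U 0F x) → Span c τ (U 0F y) → Span c τ (U 0F z)
  add eq p p′ = resp (S.sym (S.trans (U-cong 0F eq) (U-⊕ 0F _ _))) (p ⊞ p′)
U₀-Span-closed r (scale n {f} s) with U₀-Span-closed r s
... | ⟨ s₀ , s₁ , s₂ ⟩ = ⟨ mult S.refl s₀ , mult (swap f) s₁
  , mult (S.trans (S.*-congˡ (swap f)) (swap (v ⊗ f))) s₂ ⟩
  where
  swap : ∀ f → v ⊗ (# n ⊗ f) ≈ # n ⊗ (v ⊗ f)
  swap f = solve 3 (λ v n f → v :* (n :* f) := n :* (v :* f)) S.refl v (# n) f
  mult : ∀ {c x z} → z ≈ # n ⊗ x → Span c τ (U 0F x) → Span c τ (U 0F z)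
  mult {x = x} eq p = resp (S.sym (S.trans (U-cong 0F eq) (U-# 0F n x))) (scale n p)
U₀-Span-closed r (mul {f} s) with U₀-Span-closed r s
... | ⟨ s₀ , s₁ , s₂ ⟩ = ⟨ s₁ , s₂ , resp (S.sym step) (mul (s₀ ⊞ scale 3 s₁ ⊞ scale 3 s₂)) ⟩
  where
  step : U 0F (v ⊗ (v ⊗ (v ⊗ f))) ≈ τ ⊗ (U 0F f ⊕ # 3 ⊗ U 0F (v ⊗ f) ⊕ # 3 ⊗ U 0F (v ⊗ (v ⊗ f)))
  step = begin
    U 0F (v ⊗ (v ⊗ (v ⊗ f)))
      ≈⟨ U-cong 0F (begin
           v ⊗ (v ⊗ (v ⊗ f))
             ≈⟨ solve 2 (λ w f → let v = con (+ 3) :* w in v :* (v :* (v :* f)) := con (+ 27) :* w :^ 3 :* f) S.refl w f ⟩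
           # 27 ⊗ w ↑ 3 ⊗ f
             ≈⟨ S.*-congʳ (S.*-congˡ w-cubic) ⟩
           # 27 ⊗ (T ⊗ (# 1 ⊕ # 9 ⊗ w ⊕ # 27 ⊗ w ↑ 2)) ⊗ f
             ≈⟨ solve 3 (λ T w f → let v = con (+ 3) :* w in
                  con (+ 27) :* (T :* (con (+ 1) :+ con (+ 9) :* w :+ con (+ 27) :* w :^ 2)) :* f
                  := T :* (con (+ 27) :* (f :+ con (+ 3) :* (v :* f) :+ con (+ 3) :* (v :* (v :* f))))) S.refl T w f ⟩
           T ⊗ (# 27 ⊗ (f ⊕ # 3 ⊗ (v ⊗ f) ⊕ # 3 ⊗ (v ⊗ (v ⊗ f)))) ∎) ⟩
    U 0F (T ⊗ (# 27 ⊗ (f ⊕ # 3 ⊗ (v ⊗ f) ⊕ # 3 ⊗ (v ⊗ (v ⊗ f)))))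
      ≈⟨ S.trans (U-H⊗ 0F t _) (S.*-congˡ (S.trans (U-# 0F 27 _) (S.*-congˡ (S.trans (U-⊕ 0F _ _)
           (S.+-cong (S.trans (U-⊕ 0F _ _) (S.+-congˡ (U-# 0F 3 _))) (U-# 0F 3 _)))))) ⟩
    t ⊗ (# 27 ⊗ (U 0F f ⊕ # 3 ⊗ U 0F (v ⊗ f) ⊕ # 3 ⊗ U 0F (v ⊗ (v ⊗ f))))
      ≈⟨ solve 2 (λ t x → t :* (con (+ 27) :* x) := con (+ 27) :* t :* x) S.refl t _ ⟩
    τ ⊗ (U 0F f ⊕ # 3 ⊗ U 0F (v ⊗ f) ⊕ # 3 ⊗ U 0F (v ⊗ (v ⊗ f))) ∎
U₀-Span-closed r (resp eq s) with U₀-Span-closed r s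
... | ⟨ s₀ , s₁ , s₂ ⟩ = ⟨ resp (U-cong 0F eq) s₀ , resp (U-cong 0F (S.*-congˡ eq)) s₁
  , resp (U-cong 0F (S.*-congˡ (S.*-congˡ eq))) s₂ ⟩

U₀-Span-1 : U₀-Span (# 1) (# 1)
U₀-Span-1 = ⟨ resp (S.sym (U₀-const (+ 1))) base
  , resp (S.sym eq₁) (mul base)
  , resp (S.sym eq₂) (scale 2 (mul base) ⊞ scale 3 (mul (mul base))) ⟩
  where
  eq₁ : U 0F (v ⊗ # 1) ≈ τ ⊗ # 1
  eq₁ = S.trans (U-cong 0F (S.*-identityʳ v)) (S.trans (U-# 0F 3 w) (S.trans (S.*-congˡ U₀-w)
    (solve 1 (λ t → con (+ 3) :* (con (+ 9) :* t) := con (+ 27) :* t :* con (+ 1)) S.refl t)))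
  eq₂ : U 0F (v ⊗ (v ⊗ # 1)) ≈ # 2 ⊗ (τ ⊗ # 1) ⊕ # 3 ⊗ (τ ⊗ (τ ⊗ # 1))
  eq₂ = S.trans (U-cong 0F (solve 1 (λ w → con (+ 3) :* w :* (con (+ 3) :* w :* con (+ 1)) := con (+ 9) :* w :^ 2) S.refl w))
    (S.trans (U-# 0F 9 _) (S.trans (S.*-congˡ U₀-w²)
    (solve 1 (λ t → let τ = con (+ 27) :* t in con (+ 9) :* (con (+ 6) :* t :+ con (+ 243) :* t :^ 2)
      := con (+ 2) :* (τ :* con (+ 1)) :+ con (+ 3) :* (τ :* (τ :* con (+ 1)))) S.refl t)))

U₀-ℕ[v] : ∀ {f} → Span (# 1) v f → Span (# 1) τ (U 0F f)
U₀-ℕ[v] s = U₀-Span.s₀ (U₀-Span-closed U₀-Span-1 s)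

w³∈Tℕ[v] : Span (T ⊗ # 1) v (w ↑ 3)
w³∈Tℕ[v] = resp (S.sym (S.trans w-cubic (solve 2 (λ T w → let v = con (+ 3) :* w in
    T :* (con (+ 1) :+ con (+ 9) :* w :+ con (+ 27) :* w :^ 2)
    := T :* con (+ 1) :+ con (+ 3) :* (v :* (T :* con (+ 1))) :+ con (+ 3) :* (v :* (v :* (T :* con (+ 1))))) S.refl T w)))
  (base ⊞ scale 3 (mul base) ⊞ scale 3 (mul (mul base)))

U₀-Tℕ[v] : ∀ {f} → Span (T ⊗ # 1) v f → Span t τ (U 0F f)
U₀-Tℕ[v] s with Span-⊗⁻¹ T s
... | g , s′ , eq = resp (S.sym (S.trans (U-cong 0F eq) (U-H⊗ 0F t g)))
  (Span-trans (resp (S.sym (S.*-identityʳ t)) base) mul (Span-⊗ t (U₀-ℕ[v] s′)))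

-- As t lies in w ℕ[v], the product lies in w³ ℕ[v], hence in T ℕ[v]; the factor T = t(q³) leaves U₀
-- as t.
U₀-w²tℕ[τ] : ∀ {f} → Span t τ f → Span t τ (U 0F (w ↑ 2 ⊗ f))
U₀-w²tℕ[τ] s = U₀-Tℕ[v] (Span-trans
  (resp (solve 1 (λ w → w :^ 3 := w :^ 2 :* w) S.refl w) w³∈Tℕ[v]) mul (Span-⊗ (w ↑ 2) (tℕ[τ]⊆wℕ[v] s)))

-- The scaling by 3 pays off here: U₀ (v w) = 18t + 729t² = 9t(2 + 3τ), and v² w = 9w³ has its 9 in
-- front.
U₀-Span-w : U₀-Span (# 9 ⊗ t) w
U₀-Span-w = ⟨ resp (S.sym U₀-w) base
  , resp (S.sym eq₁) (scale 2 base ⊞ scale 3 (mul base))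
  , resp (S.sym eq₂) (Span-⊗ (# 9) (U₀-Tℕ[v] w³∈Tℕ[v])) ⟩
  where
  eq₁ : U 0F (v ⊗ w) ≈ # 2 ⊗ (# 9 ⊗ t) ⊕ # 3 ⊗ (τ ⊗ (# 9 ⊗ t))
  eq₁ = S.trans (U-cong 0F (solve 1 (λ w → con (+ 3) :* w :* w := con (+ 3) :* w :^ 2) S.refl w))
    (S.trans (U-# 0F 3 _) (S.trans (S.*-congˡ U₀-w²)
    (solve 1 (λ t → let τ = con (+ 27) :* t in con (+ 3) :* (con (+ 6) :* t :+ con (+ 243) :* t :^ 2)
      := con (+ 2) :* (con (+ 9) :* t) :+ con (+ 3) :* (τ :* (con (+ 9) :* t))) S.refl t)))
  eq₂ : U 0F (v ⊗ (v ⊗ w)) ≈ # 9 ⊗ U 0F (w ↑ 3)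
  eq₂ = S.trans (U-cong 0F (solve 1 (λ w → con (+ 3) :* w :* (con (+ 3) :* w :* w) := con (+ 9) :* w :^ 3) S.refl w)) (U-# 0F 9 _)

U₀-tℕ[τ] : ∀ {f} → Span t τ f → Span (# 9 ⊗ t) τ (U 0F f)
U₀-tℕ[τ] s = U₀-Span.s₀ (U₀-Span-closed U₀-Span-w (tℕ[τ]⊆wℕ[v] s))

-- Generating functions along the progressions

-- L-odd k and L-even k collect the p₁,₃(m) with 4m ≡ 1 modulo 3²ᵏ⁺¹ and 3²ᵏ⁺² respectively.
mutual
  L-odd : ℕ → ℤ⟦q⟧
  L-odd zero    = U 1F (p ↑ 2)
  L-odd (suc k) = U 0F (L-even k)

  L-even : ℕ → ℤ⟦q⟧
  L-even k = U 2F (L-odd k)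

-- The factor q turns U₂ of `L-odd k` into U₀, through which e(q³)² passes as e². Multiplication by
-- w² then makes the prefactor a series in q³ again: w² · q e² = q³ e(q⁹)².
G-odd G-even : ℕ → ℤ⟦q⟧
G-odd k  = B ↑ 2 ⊗ (q ⊗ L-odd k)
G-even k = e ↑ 2 ⊗ (q ⊗ L-even k)

w²-G-even : ∀ k → w ↑ 2 ⊗ G-even k ≈ H (q ⊗ B ↑ 2) ⊗ L-even k
w²-G-even k = begin
  (q ⊗ b ⊗ p) ↑ 2 ⊗ (e ↑ 2 ⊗ (q ⊗ L-even k))
    ≈⟨ solve 5 (λ q b p e l → (q :* b :* p) :^ 2 :* (e :^ 2 :* (q :* l)) := q :^ 3 :* b :^ 2 :* l :* (e :* p) :^ 2) S.refl q b p e (L-even k) ⟩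
  q ↑ 3 ⊗ b ↑ 2 ⊗ L-even k ⊗ (e ⊗ p) ↑ 2
    ≈⟨ S.*-cong (S.*-congʳ (S.sym (S.trans (H-⊗ q (B ↑ 2)) (S.*-cong H-q (H-↑ B 2))))) (^-congˡ 2 ep≈1) ⟩
  H (q ⊗ B ↑ 2) ⊗ L-even k ⊗ # 1 ↑ 2
    ≈⟨ solve 1 (λ x → x :* con (+ 1) :^ 2 := x) S.refl _ ⟩
  H (q ⊗ B ↑ 2) ⊗ L-even k ∎

U₀-G-odd : ∀ k → U 0F (G-odd k) ≈ G-even k
U₀-G-odd k = S.trans (U-cong 0F (S.*-congʳ (S.sym (H-↑ e 2))))
  (S.trans (U-H⊗ 0F (e ↑ 2) (q ⊗ L-odd k)) (S.*-congˡ (U₀-q⊗ (L-odd k))))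

U₂-G-odd : ∀ k → U 2F (G-odd k) ≈ e ↑ 2 ⊗ U 1F (L-odd k)
U₂-G-odd k = S.trans (U-cong 2F (S.*-congʳ (S.sym (H-↑ e 2))))
  (S.trans (U-H⊗ 2F (e ↑ 2) (q ⊗ L-odd k)) (S.*-congˡ (U₂-q⊗ (L-odd k))))

qB²-G : ∀ l → q ⊗ B ↑ 2 ⊗ l ≈ B ↑ 2 ⊗ (q ⊗ l)
qB²-G l = solve 3 (λ q b l → q :* b :^ 2 :* l := b :^ 2 :* (q :* l)) S.refl q B l

G-odd-zero : G-odd 0 ≈ U 0F (w ↑ 2)
G-odd-zero = S.sym (begin
  U 0F ((q ⊗ b ⊗ p) ↑ 2)
    ≈⟨ U-cong 0F (S.trans (solve 3 (λ q b p → (q :* b :* p) :^ 2 := b :^ 2 :* (q :* (q :* p :^ 2))) S.refl q b p)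
         (S.*-congʳ (S.sym (H-↑ B 2)))) ⟩
  U 0F (H (B ↑ 2) ⊗ (q ⊗ (q ⊗ p ↑ 2)))
    ≈⟨ S.trans (U-H⊗ 0F _ _) (S.*-congˡ (S.trans (U₀-q⊗ _) (S.*-congˡ (U₂-q⊗ _)))) ⟩
  G-odd 0 ∎)

-- The powers 3²ᵏ⁺¹ and 3²ᵏ⁺³ that divide `L-odd k` and `L-even k`; the second is three times the
-- modulus of its progression.
3^odd 3^even : ℕ → ℕ
3^odd k  = 3 ℕ.* 9 ℕ.^ k
3^even k = 27 ℕ.* 9 ℕ.^ k

#-* : ∀ m n → # (m ℕ.* n) ≈ # m ⊗ # n
#-* m n = S.trans (S.reflexive (cong const (ℤ.pos-* m n))) (const-* (+ m) (+ n))

G-odd-suc : ∀ k {f} → G-even k ≈ # (3^even k) ⊗ f → G-odd (suc k) ≈ # (3^odd (suc k)) ⊗ U 0F (w ↑ 2 ⊗ f)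
G-odd-suc k {f} eq = begin
  B ↑ 2 ⊗ (q ⊗ U 0F (L-even k))
    ≈⟨ qB²-G _ ⟨
  q ⊗ B ↑ 2 ⊗ U 0F (L-even k)
    ≈⟨ U-H⊗ 0F (q ⊗ B ↑ 2) (L-even k) ⟨
  U 0F (H (q ⊗ B ↑ 2) ⊗ L-even k)
    ≈⟨ U-cong 0F (S.trans (S.sym (w²-G-even k)) (S.trans (S.*-congˡ eq)
         (solve 3 (λ w c f → w :^ 2 :* (c :* f) := c :* (w :^ 2 :* f)) S.refl w (# (3^even k)) f))) ⟩
  U 0F (# (3^even k) ⊗ (w ↑ 2 ⊗ f))
    ≈⟨ U-# 0F (3^even k) _ ⟩
  # (3^even k) ⊗ U 0F (w ↑ 2 ⊗ f)
    ≈⟨ S.*-congʳ (S.reflexive (cong # (ℕ.*-assoc 3 9 (9 ℕ.^ k)))) ⟩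
  # (3^odd (suc k)) ⊗ U 0F (w ↑ 2 ⊗ f) ∎

G-even-from-odd : ∀ k {f g} → G-odd k ≈ # (3^odd k) ⊗ f → U 0F f ≈ # 9 ⊗ g → G-even k ≈ # (3^even k) ⊗ g
G-even-from-odd k {f} {g} eq eq′ = begin
  G-even k
    ≈⟨ U₀-G-odd k ⟨
  U 0F (G-odd k)
    ≈⟨ S.trans (U-cong 0F eq) (U-# 0F (3^odd k) f) ⟩
  # (3^odd k) ⊗ U 0F f
    ≈⟨ S.*-congˡ eq′ ⟩
  # (3^odd k) ⊗ (# 9 ⊗ g)
    ≈⟨ S.trans (S.sym (S.*-assoc _ _ _)) (S.*-congʳ (S.sym (#-* (3^odd k) 9))) ⟩
  # (3^odd k ℕ.* 9) ⊗ g
    ≈⟨ S.*-congʳ (S.reflexive (cong # (lem (9 ℕ.^ k)))) ⟩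
  # (3^even k) ⊗ g ∎
  where
  lem : ∀ m → 3 ℕ.* m ℕ.* 9 ≡ 27 ℕ.* m
  lem = ℕ-Solver.solve-∀

G-odd-zero-Span : G-odd 0 ≈ # 3 ⊗ (# 2 ⊗ t ⊕ # 3 ⊗ (τ ⊗ t))
G-odd-zero-Span = S.trans G-odd-zero (S.trans U₀-w² (solve 1 (λ t → con (+ 6) :* t :+ con (+ 243) :* t :^ 2
    := con (+ 3) :* (con (+ 2) :* t :+ con (+ 3) :* (con (+ 27) :* t :* t))) S.refl t))

G-odd-Span  : ∀ k → ∃ λ f → Span t τ f × G-odd k ≈ # (3^odd k) ⊗ f
G-even-Span : ∀ k → ∃ λ f → Span t τ f × G-even k ≈ # (3^even k) ⊗ f

G-odd-Span zero = _ , scale 2 base ⊞ scale 3 (mul base) , G-odd-zero-Span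
G-odd-Span (suc k) =
  let f , s , eq = G-even-Span k in _ , U₀-w²tℕ[τ] s , G-odd-suc k eq
G-even-Span k =
  let f , s , eq = G-odd-Span k ; g , s′ , eq′ = Span-⊗⁻¹ (# 9) (U₀-tℕ[τ] s)
  in g , s′ , G-even-from-odd k eq eq′

-- Divisibility of the series and the remaining residue classes

infix 4 _∣ˢ_

record _∣ˢ_ (c : ℕ) (f : ℤ⟦q⟧) : Set where
  constructor quotient
  field
    {quot} : ℤ⟦q⟧
    factor : f ≈ # c ⊗ quot

∣ˢ-resp : ∀ {c f g} → f ≈ g → c ∣ˢ f → c ∣ˢ g
∣ˢ-resp eq (quotient eq′) = quotient (S.trans (S.sym eq) eq′)

∣ˢ-⊗ˡ : ∀ {c} f {g} → c ∣ˢ g → c ∣ˢ f ⊗ g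
∣ˢ-⊗ˡ {c} f (quotient {h} eq) = quotient
  (S.trans (S.*-congˡ eq) (solve 3 (λ f c h → f :* (c :* h) := c :* (f :* h)) S.refl f (# c) h))

∣ˢ-tail : ∀ {c f} → c ∣ˢ q ⊗ f → c ∣ˢ f
∣ˢ-tail {c} {f} (quotient {h} eq) = quotient {quot = tl h} (coeffs λ n →
  trans (sym (q⊗-suc f n)) (trans (coeff eq (suc n))
  (trans (⊗-const (+ c) h (suc n)) (sym (⊗-const (+ c) (tl h) n)))))

∣ˢ-cancel² : ∀ {c} x y {f} → x ⊗ y ≈ # 1 → c ∣ˢ x ↑ 2 ⊗ f → c ∣ˢ f
∣ˢ-cancel² x y {f} xy≈1 d = ∣ˢ-resp
  (S.trans (solve 3 (λ x y f → y :^ 2 :* (x :^ 2 :* f) := (x :* y) :^ 2 :* f) S.refl x y f)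
    (S.trans (S.*-congʳ (^-congˡ 2 xy≈1)) (solve 1 (λ f → con (+ 1) :^ 2 :* f := f) S.refl f)))
  (∣ˢ-⊗ˡ (y ↑ 2) d)

3^odd∣L-odd : ∀ k → 3^odd k ∣ˢ L-odd k
3^odd∣L-odd k = let f , _ , eq = G-odd-Span k in
  ∣ˢ-tail (∣ˢ-cancel² B (H p) BHp≈1 (quotient {quot = f} eq))

3^even∣L-even : ∀ k → 3^even k ∣ˢ L-even k
3^even∣L-even k = let f , _ , eq = G-even-Span k in
  ∣ˢ-tail (∣ˢ-cancel² e p ep≈1 (quotient {quot = f} eq))

-- Each τ carries a 27, so modulo 27 only the constant term of the polynomial survives.
tℕ[τ]-leading : ∀ {f} → Span t τ f → ∃ λ n → ∃ λ g → f ≈ # n ⊗ t ⊕ # 27 ⊗ g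
tℕ[τ]-leading base = 1 , # 0 , solve 1 (λ t → t := con (+ 1) :* t :+ con (+ 27) :* con (+ 0)) S.refl t
tℕ[τ]-leading (s ⊞ s′) with tℕ[τ]-leading s | tℕ[τ]-leading s′
... | m , g , eq | n , h , eq′ = m ℕ.+ n , g ⊕ h , S.trans (S.+-cong eq eq′)
  (S.trans (solve 5 (λ m n t g h → m :* t :+ con (+ 27) :* g :+ (n :* t :+ con (+ 27) :* h)
      := (m :+ n) :* t :+ con (+ 27) :* (g :+ h)) S.refl (# m) (# n) t g h)
    (S.+-congʳ (S.*-congʳ (S.sym (const-+ (+ m) (+ n))))))
tℕ[τ]-leading (scale m s) with tℕ[τ]-leading s
... | n , g , eq = m ℕ.* n , # m ⊗ g , S.trans (S.*-congˡ eq)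
  (S.trans (solve 4 (λ m n t g → m :* (n :* t :+ con (+ 27) :* g) := m :* n :* t :+ con (+ 27) :* (m :* g)) S.refl (# m) (# n) t g)
    (S.+-congʳ (S.*-congʳ (S.sym (#-* m n)))))
tℕ[τ]-leading (mul {f} s) = 0 , t ⊗ f , solve 2 (λ t f → con (+ 27) :* t :* f := con (+ 0) :* t :+ con (+ 27) :* (t :* f)) S.refl t f
tℕ[τ]-leading (resp eq s) with tℕ[τ]-leading s
... | n , g , eq′ = n , g , S.trans (S.sym eq) eq′

-- Modulo 3 the series f is n t, and t is w, whose U₂ is 3Y.
U₂-tℕ[τ] : ∀ {f} → Span t τ f → 3 ∣ˢ U 2F f
U₂-tℕ[τ] {f} s with tℕ[τ]-leading s
... | n , g , eq = quotient (begin
  U 2F f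
    ≈⟨ U-cong 2F (S.trans eq (S.+-congʳ (S.*-congˡ t-poly))) ⟩
  U 2F (# n ⊗ (w ⊗ (# 1 ⊕ # 9 ⊗ w ⊕ # 27 ⊗ w ↑ 2)) ⊕ # 27 ⊗ g)
    ≈⟨ U-cong 2F (solve 3 (λ n w g → n :* (w :* (con (+ 1) :+ con (+ 9) :* w :+ con (+ 27) :* w :^ 2)) :+ con (+ 27) :* g
         := n :* w :+ con (+ 3) :* (n :* (con (+ 3) :* w :^ 2 :+ con (+ 9) :* w :^ 3) :+ con (+ 9) :* g)) S.refl (# n) w g) ⟩
  U 2F (# n ⊗ w ⊕ # 3 ⊗ r)
    ≈⟨ S.trans (U-⊕ 2F _ _) (S.+-cong (S.trans (U-# 2F n w) (S.*-congˡ U₂-w)) (U-# 2F 3 r)) ⟩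
  # n ⊗ (# 3 ⊗ Y) ⊕ # 3 ⊗ U 2F r
    ≈⟨ solve 3 (λ n y r → n :* (con (+ 3) :* y) :+ con (+ 3) :* r := con (+ 3) :* (n :* y :+ r)) S.refl (# n) Y (U 2F r) ⟩
  # 3 ⊗ (# n ⊗ Y ⊕ U 2F r) ∎)
  where r = # n ⊗ (# 3 ⊗ w ↑ 2 ⊕ # 9 ⊗ w ↑ 3) ⊕ # 9 ⊗ g

-- With c = 1 + 9w + 27w² one has w² t = w³ c = T c², and c² is 1 + 18w modulo 27.
w²tℕ[τ]-leading : ∀ {f} → Span t τ f →
  ∃ λ n → ∃ λ g → w ↑ 2 ⊗ f ≈ T ⊗ (# n ⊕ # 18 ⊗ (# n ⊗ w)) ⊕ # 27 ⊗ g
w²tℕ[τ]-leading {f} s = let n , g , eq = tℕ[τ]-leading s in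
  -- The rest of c² is 135w² + 486w³ + 729w⁴, which is 27 times the bracket.
  n , T ⊗ # n ⊗ (# 5 ⊗ w ↑ 2 ⊕ # 18 ⊗ w ↑ 3 ⊕ # 27 ⊗ w ↑ 4) ⊕ w ↑ 2 ⊗ g , (begin
  w ↑ 2 ⊗ f
    ≈⟨ S.*-congˡ (S.trans eq (S.+-congʳ (S.*-congˡ t-poly))) ⟩
  w ↑ 2 ⊗ (# n ⊗ (w ⊗ c) ⊕ # 27 ⊗ g)
    ≈⟨ solve 4 (λ w n c g → w :^ 2 :* (n :* (w :* c) :+ con (+ 27) :* g) := n :* (w :^ 3 :* c) :+ con (+ 27) :* (w :^ 2 :* g))
         S.refl w (# n) c g ⟩
  # n ⊗ (w ↑ 3 ⊗ c) ⊕ # 27 ⊗ (w ↑ 2 ⊗ g)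
    ≈⟨ S.+-congʳ (S.*-congˡ (S.*-congʳ w-cubic)) ⟩
  # n ⊗ (T ⊗ c ⊗ c) ⊕ # 27 ⊗ (w ↑ 2 ⊗ g)
    ≈⟨ solve 4 (λ n T w h → let c = con (+ 1) :+ con (+ 9) :* w :+ con (+ 27) :* w :^ 2 in
         n :* (T :* c :* c) :+ con (+ 27) :* h
         := T :* (n :+ con (+ 18) :* (n :* w)) :+ con (+ 27) :* (T :* n :* (con (+ 5) :* w :^ 2 :+ con (+ 18) :* w :^ 3 :+ con (+ 27) :* w :^ 4) :+ h))
       S.refl (# n) T w (w ↑ 2 ⊗ g) ⟩
  T ⊗ (# n ⊕ # 18 ⊗ (# n ⊗ w)) ⊕ # 27 ⊗ (T ⊗ # n ⊗ (# 5 ⊗ w ↑ 2 ⊕ # 18 ⊗ w ↑ 3 ⊕ # 27 ⊗ w ↑ 4) ⊕ w ↑ 2 ⊗ g) ∎)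
  where c = # 1 ⊕ # 9 ⊗ w ⊕ # 27 ⊗ w ↑ 2

U-T⊗ : ∀ r m f g → U (suc r) (T ⊗ (# m ⊕ # 18 ⊗ f) ⊕ # 27 ⊗ g) ≈
  t ⊗ (# 18 ⊗ U (suc r) f) ⊕ # 27 ⊗ U (suc r) g
U-T⊗ r m f g = begin
  U s (T ⊗ (# m ⊕ # 18 ⊗ f) ⊕ # 27 ⊗ g)
    ≈⟨ U-⊕ s (T ⊗ (# m ⊕ # 18 ⊗ f)) (# 27 ⊗ g) ⟩
  U s (T ⊗ (# m ⊕ # 18 ⊗ f)) ⊕ U s (# 27 ⊗ g)
    ≈⟨ S.+-cong (U-H⊗ s t (# m ⊕ # 18 ⊗ f)) (U-# s 27 g) ⟩
  t ⊗ U s (# m ⊕ # 18 ⊗ f) ⊕ # 27 ⊗ U s g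
    ≈⟨ S.+-congʳ (S.*-congˡ (U-⊕ s (# m) (# 18 ⊗ f))) ⟩
  t ⊗ (U s (# m) ⊕ U s (# 18 ⊗ f)) ⊕ # 27 ⊗ U s g
    ≈⟨ S.+-congʳ (S.*-congˡ (S.+-cong (U-suc-const r (+ m)) (U-# s 18 f))) ⟩
  t ⊗ (# 0 ⊕ # 18 ⊗ U s f) ⊕ # 27 ⊗ U s g
    ≈⟨ S.+-congʳ (S.*-congˡ (S.+-identityˡ _)) ⟩
  t ⊗ (# 18 ⊗ U s f) ⊕ # 27 ⊗ U s g ∎
  where s = suc r

U₁-w²tℕ[τ] : ∀ {f} → Span t τ f → 9 ∣ˢ U 1F (w ↑ 2 ⊗ f)
U₁-w²tℕ[τ] {f} s = let n , g , eq = w²tℕ[τ]-leading s in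
  quotient {quot = # 2 ⊗ t ⊗ U 1F (# n ⊗ w) ⊕ # 3 ⊗ U 1F g} (begin
  U 1F (w ↑ 2 ⊗ f)
    ≈⟨ S.trans (U-cong 1F eq) (U-T⊗ 0F n (# n ⊗ w) g) ⟩
  t ⊗ (# 18 ⊗ U 1F (# n ⊗ w)) ⊕ # 27 ⊗ U 1F g
    ≈⟨ solve 3 (λ t x g → t :* (con (+ 18) :* x) :+ con (+ 27) :* g
         := con (+ 9) :* (con (+ 2) :* t :* x :+ con (+ 3) :* g)) S.refl t (U 1F (# n ⊗ w)) (U 1F g) ⟩
  # 9 ⊗ (# 2 ⊗ t ⊗ U 1F (# n ⊗ w) ⊕ # 3 ⊗ U 1F g) ∎)

-- The constant n has no part in class 2, and U₂ w = 3Y raises 18 to 54. In class 1 this extra 3 is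
-- not at hand, which leaves 9.
U₂-w²tℕ[τ] : ∀ {f} → Span t τ f → 27 ∣ˢ U 2F (w ↑ 2 ⊗ f)
U₂-w²tℕ[τ] {f} s = let n , g , eq = w²tℕ[τ]-leading s in
  quotient {quot = # 2 ⊗ t ⊗ # n ⊗ Y ⊕ U 2F g} (begin
  U 2F (w ↑ 2 ⊗ f)
    ≈⟨ S.trans (U-cong 2F eq) (U-T⊗ 1F n (# n ⊗ w) g) ⟩
  t ⊗ (# 18 ⊗ U 2F (# n ⊗ w)) ⊕ # 27 ⊗ U 2F g
    ≈⟨ S.+-congʳ (S.*-congˡ (S.*-congˡ (S.trans (U-# 2F n w) (S.*-congˡ U₂-w)))) ⟩
  t ⊗ (# 18 ⊗ (# n ⊗ (# 3 ⊗ Y))) ⊕ # 27 ⊗ U 2F g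
    ≈⟨ solve 4 (λ t n y g → t :* (con (+ 18) :* (n :* (con (+ 3) :* y))) :+ con (+ 27) :* g
         := con (+ 27) :* (con (+ 2) :* t :* n :* y :+ g)) S.refl t (# n) Y (U 2F g) ⟩
  # 27 ⊗ (# 2 ⊗ t ⊗ # n ⊗ Y ⊕ U 2F g) ∎)

∣ˢ-scale : ∀ m n {f g} → f ≈ # m ⊗ g → n ∣ˢ g → m ℕ.* n ∣ˢ f
∣ˢ-scale m n {f} {g} eq (quotient {h} eq′) = quotient {quot = h} (begin
  f                  ≈⟨ S.trans eq (S.*-congˡ eq′) ⟩
  # m ⊗ (# n ⊗ h)    ≈⟨ S.*-assoc _ _ _ ⟨
  # m ⊗ # n ⊗ h      ≈⟨ S.*-congʳ (#-* m n) ⟨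
  # (m ℕ.* n) ⊗ h    ∎)

U₁-L-odd : ∀ k → 3^odd k ℕ.* 3 ∣ˢ U 1F (L-odd k)
U₁-L-odd k = let f , s , eq = G-odd-Span k in
  ∣ˢ-cancel² e p ep≈1 (∣ˢ-scale (3^odd k) 3
    (S.trans (S.sym (U₂-G-odd k)) (S.trans (U-cong 2F eq) (U-# 2F (3^odd k) f)))
    (U₂-tℕ[τ] s))

w²-G-even-factor : ∀ k {f} → G-even k ≈ # (3^even k) ⊗ f →
  H (q ⊗ B ↑ 2) ⊗ L-even k ≈ # (3^even k) ⊗ (w ↑ 2 ⊗ f)
w²-G-even-factor k {f} eq = S.trans (S.sym (w²-G-even k)) (S.trans (S.*-congˡ eq)
  (solve 3 (λ x c f → x :* (c :* f) := c :* (x :* f)) S.refl (w ↑ 2) (# (3^even k)) f))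

U₁-L-even : ∀ k → 3^even k ℕ.* 9 ∣ˢ U 1F (L-even k)
U₁-L-even k = let f , s , eq = G-even-Span k in
  ∣ˢ-tail (∣ˢ-cancel² B (H p) BHp≈1 (∣ˢ-resp (qB²-G _) (∣ˢ-scale (3^even k) 9
    (S.trans (S.sym (U-H⊗ 1F (q ⊗ B ↑ 2) (L-even k)))
      (S.trans (U-cong 1F (w²-G-even-factor k eq)) (U-# 1F (3^even k) (w ↑ 2 ⊗ f))))
    (U₁-w²tℕ[τ] s))))

U₂-L-even : ∀ k → 3^even k ℕ.* 27 ∣ˢ U 2F (L-even k)
U₂-L-even k = let f , s , eq = G-even-Span k in
  ∣ˢ-tail (∣ˢ-cancel² B (H p) BHp≈1 (∣ˢ-resp (qB²-G _) (∣ˢ-scale (3^even k) 27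
    (S.trans (S.sym (U-H⊗ 2F (q ⊗ B ↑ 2) (L-even k)))
      (S.trans (U-cong 2F (w²-G-even-factor k eq)) (U-# 2F (3^even k) (w ↑ 2 ⊗ f))))
    (U₂-w²tℕ[τ] s))))

-- Indices of the progressions and the five congruences

ι-p13 : ι p13 ≈ p ↑ 2
ι-p13 = S.trans
  (S.trans (ι-⊛ _ _) (S.*-congˡ (S.trans (ι-⊛ _ _) (S.*-congˡ (S.trans (ι-⊛ _ _) (S.*-congˡ
    (S.trans (ι-⊛ _ _) (S.*-congˡ (ι-⊛ prodInv prodInv)))))))))
  (solve 1 (λ x → x :* (x :* (x :* (x :* (x :* x)))) := (x :^ 3) :^ 2) S.refl qPoch∞⁻¹)

record Progression (f : ℤ⟦q⟧) (c d : ℕ) : Set where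
  constructor progression
  field term : ∀ n → f n ≡ + p13 (c ℕ.* n ℕ.+ d)
open Progression

U-Progression : ∀ r {f c d} → Progression f c d → Progression (U r f) (3 ℕ.* c) (c ℕ.* toℕ r ℕ.+ d)
U-Progression r {f} {c} {d} p = progression λ n → trans (term p (n ℕ.* 3 ℕ.+ toℕ r)) (cong (λ m → + p13 m) (lem c n (toℕ r) d))
  where
  lem : ∀ c n r d → c ℕ.* (n ℕ.* 3 ℕ.+ r) ℕ.+ d ≡ 3 ℕ.* c ℕ.* n ℕ.+ (c ℕ.* r ℕ.+ d)
  lem = ℕ-Solver.solve-∀

-- Four times the offset avoids division. With z = 9ᵏ, passing to U₂ adds 4 · 2 · 3z to 3z + 1,
-- which gives 27z + 1; passing to U₀ leaves the offset as it is.
L-odd-Progression  : ∀ k → ∃ λ d → 4 ℕ.* d ≡ 3^odd k ℕ.+ 1 × Progression (L-odd k) (3^odd k) d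
L-even-Progression : ∀ k → ∃ λ d → 4 ℕ.* d ≡ 3^even k ℕ.+ 1 × Progression (L-even k) (9 ℕ.* 9 ℕ.^ k) d

L-odd-Progression zero = 1 , refl , U-Progression 1F p²-Progression
  where
  p²-Progression : Progression (p ↑ 2) 1 0
  p²-Progression = progression λ n → trans (sym (coeff ι-p13 n))
    (cong (λ m → + p13 m) (sym (trans (ℕ.+-identityʳ _) (ℕ.+-identityʳ n))))
L-odd-Progression (suc k) = let d , eq , pr = L-even-Progression k in
    9 ℕ.* 9 ℕ.^ k ℕ.* 0 ℕ.+ d
  , trans (cong (λ x → 4 ℕ.* (x ℕ.+ d)) (ℕ.*-zeroʳ (9 ℕ.* 9 ℕ.^ k)))
      (trans eq (cong (ℕ._+ 1) (ℕ.*-assoc 3 9 (9 ℕ.^ k))))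
  , U-Progression 0F pr
L-even-Progression k = let d , eq , pr = L-odd-Progression k in
    3 ℕ.* 9 ℕ.^ k ℕ.* 2 ℕ.+ d
  , trans (ℕ.*-distribˡ-+ 4 (3 ℕ.* 9 ℕ.^ k ℕ.* 2) d)
      (trans (cong (4 ℕ.* (3 ℕ.* 9 ℕ.^ k ℕ.* 2) ℕ.+_) eq) (lem (9 ℕ.^ k)))
  , subst (λ c → Progression (L-even k) c (3 ℕ.* 9 ℕ.^ k ℕ.* 2 ℕ.+ d)) (sym (ℕ.*-assoc 3 3 (9 ℕ.^ k))) (U-Progression 2F pr)
  where
  lem : ∀ z → 4 ℕ.* (3 ℕ.* z ℕ.* 2) ℕ.+ (3 ℕ.* z ℕ.+ 1) ≡ 27 ℕ.* z ℕ.+ 1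
  lem = ℕ-Solver.solve-∀

∣ˢ⇒∣p13 : ∀ {f C D d x} n → Progression f C d → D ∣ˢ f → 4 ℕ.* d ≡ x → D ∣ p13 (C ℕ.* n ℕ.+ x / 4)
∣ˢ⇒∣p13 {f} {C} {D} {d} n pr (quotient {h} eq) refl =
  subst (λ m → D ∣ p13 (C ℕ.* n ℕ.+ m)) (sym (trans (cong (_/ 4) (ℕ.*-comm 4 d)) (m*n/n≡m d 4)))
    (divides ℤ.∣ h n ∣ (trans (cong ℤ.∣_∣ (trans (sym (term pr n)) (trans (coeff eq n) (⊗-const (+ D) h n))))
      (trans (ℤ.abs-* (+ D) (h n)) (ℕ.*-comm D ℤ.∣ h n ∣))))

-- The five parameters stand for 3 to the powers 2α-1, 2α, 2α+1, 2α+3, 2α+4 with α = k + 1; kept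
-- abstract, they are replaced by multiples of 9ᵏ in one match.
five-congruences : ∀ k n {a b c d e} → let z = 9 ℕ.^ k in
  a ≡ 3 ℕ.* z → b ≡ 9 ℕ.* z → c ≡ 27 ℕ.* z → d ≡ 243 ℕ.* z → e ≡ 729 ℕ.* z →
    (a ∣ p13 (a ℕ.* n ℕ.+ (a ℕ.+ 1) / 4))
  × (d ∣ p13 (c ℕ.* n ℕ.+ (7 ℕ.* b ℕ.+ 1) / 4))
  × (e ∣ p13 (c ℕ.* n ℕ.+ (11 ℕ.* b ℕ.+ 1) / 4))
  × (b ∣ p13 (b ℕ.* n ℕ.+ (5 ℕ.* a ℕ.+ 1) / 4))
  × (c ∣ p13 (b ℕ.* n ℕ.+ (c ℕ.+ 1) / 4))
five-congruences k n refl refl refl refl refl =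
  let d₁ , eq₁ , pr₁ = L-odd-Progression k
      d₂ , eq₂ , pr₂ = L-even-Progression k
  in ∣ˢ⇒∣p13 n pr₁ (3^odd∣L-odd k) eq₁
   , ∣ˢ⇒∣p13 n (cast (27z z) (U-Progression 1F pr₂)) (subst (_∣ˢ U 1F (L-even k)) (243z z) (U₁-L-even k))
       (offset (9 ℕ.* z) 1 d₂ eq₂ (off₇ z))
   , ∣ˢ⇒∣p13 n (cast (27z z) (U-Progression 2F pr₂)) (subst (_∣ˢ U 2F (L-even k)) (729z z) (U₂-L-even k))
       (offset (9 ℕ.* z) 2 d₂ eq₂ (off₁₁ z))
   , ∣ˢ⇒∣p13 n (cast (9z z) (U-Progression 1F pr₁)) (subst (_∣ˢ U 1F (L-odd k)) (9z′ z) (U₁-L-odd k))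
       (offset (3 ℕ.* z) 1 d₁ eq₁ (off₅ z))
   , ∣ˢ⇒∣p13 n pr₂ (3^even∣L-even k) eq₂
  where
  z = 9 ℕ.^ k
  cast : ∀ {f c c′ d} → c ≡ c′ → Progression f c d → Progression f c′ d
  cast refl pr = pr
  offset : ∀ c r d {y x} → 4 ℕ.* d ≡ y → 4 ℕ.* (c ℕ.* r) ℕ.+ y ≡ x → 4 ℕ.* (c ℕ.* r ℕ.+ d) ≡ x
  offset c r d refl eq = trans (ℕ.*-distribˡ-+ 4 (c ℕ.* r) d) eq
  27z : ∀ z → 3 ℕ.* (9 ℕ.* z) ≡ 27 ℕ.* z
  27z = ℕ-Solver.solve-∀
  9z : ∀ z → 3 ℕ.* (3 ℕ.* z) ≡ 9 ℕ.* z
  9z = ℕ-Solver.solve-∀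
  9z′ : ∀ z → 3 ℕ.* z ℕ.* 3 ≡ 9 ℕ.* z
  9z′ = ℕ-Solver.solve-∀
  243z : ∀ z → 27 ℕ.* z ℕ.* 9 ≡ 243 ℕ.* z
  243z = ℕ-Solver.solve-∀
  729z : ∀ z → 27 ℕ.* z ℕ.* 27 ≡ 729 ℕ.* z
  729z = ℕ-Solver.solve-∀
  off₅ : ∀ z → 4 ℕ.* (3 ℕ.* z ℕ.* 1) ℕ.+ (3 ℕ.* z ℕ.+ 1) ≡ 5 ℕ.* (3 ℕ.* z) ℕ.+ 1
  off₅ = ℕ-Solver.solve-∀
  off₇ : ∀ z → 4 ℕ.* (9 ℕ.* z ℕ.* 1) ℕ.+ (27 ℕ.* z ℕ.+ 1) ≡ 7 ℕ.* (9 ℕ.* z) ℕ.+ 1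
  off₇ = ℕ-Solver.solve-∀
  off₁₁ : ∀ z → 4 ℕ.* (9 ℕ.* z ℕ.* 2) ℕ.+ (27 ℕ.* z ℕ.+ 1) ≡ 11 ℕ.* (9 ℕ.* z) ℕ.+ 1
  off₁₁ = ℕ-Solver.solve-∀

open import Data.Nat using (_+_; _*_; _∸_; _^_; _≤_)

theorem1p1 : (n α : ℕ) → 1 ≤ α →
    (3 ^ (2 * α ∸ 1) ∣ p13 (3 ^ (2 * α ∸ 1) * n + (3 ^ (2 * α ∸ 1) + 1) / 4))
    × (3 ^ (2 * α + 3) ∣ p13 (3 ^ (2 * α + 1) * n + (7 * 3 ^ (2 * α) + 1) / 4))
    × (3 ^ (2 * α + 4) ∣ p13 (3 ^ (2 * α + 1) * n + (11 * 3 ^ (2 * α) + 1) / 4))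
    × (3 ^ (2 * α) ∣ p13 (3 ^ (2 * α) * n + (5 * 3 ^ (2 * α ∸ 1) + 1) / 4))
    × (3 ^ (2 * α + 1) ∣ p13 (3 ^ (2 * α) * n + (3 ^ (2 * α + 1) + 1) / 4))
theorem1p1 n (suc k) _ = five-congruences k n
  -- `3 ^ (2 * suc k)` unfolds to 3 times the power with exponent `2 * suc k ∸ 1`, so the truncated
  -- exponent is reached by cancelling a 3.
  (ℕ.*-cancelˡ-≡ _ _ 3 (trans pow₀ (ℕ.*-assoc 3 3 (9 ^ k)))) pow₀ (pow 1) (pow 3) (pow 4)
  where
  pow₀ : 3 ^ (2 * suc k) ≡ 9 * 9 ^ k
  pow₀ = sym (ℕ.^-*-assoc 3 2 (suc k))
  pow : ∀ i → 3 ^ (2 * suc k + i) ≡ 3 ^ i * 9 * 9 ^ k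
  pow i = trans (ℕ.^-distribˡ-+-* 3 (2 * suc k) i)
    (trans (ℕ.*-comm (3 ^ (2 * suc k)) (3 ^ i)) (trans (cong (3 ^ i *_) pow₀) (sym (ℕ.*-assoc (3 ^ i) 9 (9 ^ k)))))
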